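{- Let $P$ and $R$ be two general logic programs such that $P\cup R$ is well-moded and $P$ extends $R$, and let $M$ be a complete model of $P\cup R$. Suppose that (1) $P$ is acceptable with respect to a moded level mapping $|\ |$ and $M$; (2) for all well-moded queries $Q$, all LDNF-derivations of $R\cup\{Q\}$ are finite. Then for all well-moded queries $Q$, all LDNF-derivations of $(P\cup R)\cup\{Q\}$ are finite.
   Context: **Programs.** All programs and queries are over a fixed first-order language with at least one constant. A literal is an atom or a negated atom. A (general) clause is $H\leftarrow L_1,\ldots,L_n$ ($n\ge 0$), $H$ an atom, $L_i$ literals. A (general) query is a finite, possibly empty, sequence of literals. A (general) program is a finite set of clauses. $B_P$ is the set of ground atoms whose predicate symbol occurs in $P$; $\mathit{ground}(P)$ is the set of ground instances of clauses of $P$. **LDNF-resolution (leftmost selection rule).** For a program $P$ and a non-empty query $Q=L,\mathbf{L}$: (i) if $L=A$ is an atom, the resolvents of $Q$ are the queries $(\mathbf{B},\mathbf{L})\theta$ for $H\leftarrow\mathbf{B}$ a variant of a clause of $P$ renamed apart from $Q$ and $\theta=\mathrm{mgu}(A,H)$; (ii) if $L=\neg A$ with $A$ ground, a subsidiary LDNF-tree for $P\cup\{A\}$ is constructed; if this tree is finite and finitely failed, $Q$ has the single resolvent $\mathbf{L}$; if it is finite and has a successful branch, $Q$ fails; if its construction diverges, the derivation containing $Q$ is considered infinite; (iii) if $L=\neg A$ with $A$ non-ground, the derivation flounders: it ends (finitely) with no resolvent. A branch is successful if it ends in the empty query; it is failed if it ends in a query whose first literal is positive with no resolvent, or negative and ground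 with a finite subsidiary tree having a successful branch. A tree is finitely failed if it is finite and all its branches are failed. The branches of the LDNF-tree of $P\cup\{Q\}$ are its LDNF-derivations. "All LDNF-derivations of $P\cup\{Q\}$ are finite" means that the interpreter terminates: there is no infinite sequence $Q=Q_0,Q_1,Q_2,\ldots$ where each $Q_{k+1}$ is a resolvent of $Q_k$ or, if $Q_k$ begins with a ground negative literal $\neg A$, the root $A$ of its subsidiary tree. **Modes.** A mode for an $n$-ary predicate $p$ is a function $m_p:\{1,\ldots,n\}\to\{+,-\}$; $i$ is an input position if $m_p(i)=+$ and an output position if $m_p(i)=-$. Every predicate symbol has a fixed unique mode. A literal (positive or negative) is written $p(\mathbf{s},\mathbf{t})$ with $\mathbf{s}$ the terms in the input positions and $\mathbf{t}$ those in the output positions. A query $p_1(\mathbf{s}_1,\mathbf{t}_1),\ldots,p_n(\mathbf{s}_n,\mathbf{t}_n)$ is well-moded if $\mathit{Var}(\mathbf{s}_i)\subseteq\bigcup_{j=1}^{i-1}\mathit{Var}(\mathbf{t}_j)$ for all $i\in\{1,\ldots,n\}$. A clause $p(\mathbf{t}_0,\mathbf{s}_{n+1})\leftarrow p_1(\mathbf{s}_1,\mathbf{t}_1),\ldots,p_n(\mathbf{s}_n,\mathbf{t}_n)$ (where $\mathbf{t}_0$ are the input terms and $\mathbf{s}_{n+1}$ the output terms of the head) is well-moded if $\mathit{Var}(\mathbf{s}_i)\subseteq\bigcup_{j=0}^{i-1}\mathit{Var}(\mathbf{t}_j)$ for all $i\in\{1,\ldots,n+1\}$. A program is well-moded if all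 its clauses are. **Level mappings.** A level mapping for $P$ is a function $|\ |:B_P\to\mathbf{N}$, extended to ground literals by $|\neg A|=|A|$. It is a moded level mapping if $|p(\mathbf{s},\mathbf{t})|=|p(\mathbf{s},\mathbf{u})|$ for all $p$ and all (ground) $\mathbf{s},\mathbf{t},\mathbf{u}$. **Complete model.** $p$ refers to $q$ if some clause of $P$ has $p$ in its head and $q$ in its body; "depends on" is the reflexive transitive closure of "refers to". $\mathit{Neg}_P$ is the set of relations occurring in a negative literal in a clause of $P$; $\mathit{Neg}^*_P$ is the set of relations on which relations in $\mathit{Neg}_P$ depend; $P^-$ is the set of clauses of $P$ defining relations in $\mathit{Neg}^*_P$. A model $M$ of $P$ is complete if its restriction to the relations in $\mathit{Neg}^*_P$ is a model of Clark's completion $\mathit{comp}(P^-)$ (with the free equality axioms; a relation in $\mathit{Neg}^*_P$ having no clauses is completed by $\forall \mathbf{x}\,\neg p(\mathbf{x})$). **Acceptability.** Let $|\ |$ be a level mapping for $P$ and $M$ a complete model (here: of the whole program $P\cup R$). $P$ is acceptable w.r.t. $|\ |$ and $M$ if for every clause $A\leftarrow\mathbf{A},B,\mathbf{B}$ in $\mathit{ground}(P)$ (with $B$ a literal and $\mathbf{A},\mathbf{B}$ sequences of literals): if $M\models\mathbf{A}$ then $|A|>|B|$. **Extension.** A relation is defined in $P$ if it occurs in the head of a clause of $P$. $P$ extends $R$ if no relation defined in $P$ occurs in $R$. -}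

module Defs where

open import Data.Empty using (⊥)
open import Data.Fin.Base using (Fin)
open import Data.List.Base using (List; []; _∷_; [_]; _++_; map)
open import Data.List.Membership.Propositional using (_∈_)
open import Data.List.Relation.Unary.All using (All)
open import Data.List.Relation.Unary.Any using (Any)
open import Data.Nat.Base using (ℕ; suc; _≤_; _>_)
open import Data.Product.Base using (Σ; ∃-syntax; _×_)
open import Data.Vec.Base using (Vec; []; _∷_; lookup)
import Data.Vec.Relation.Unary.Any as VecAny
open import Data.Vec.Relation.Binary.Pointwise.Inductive using (Pointwise)
open import Data.Unit.Base using (⊤)
open import Function.Bundles using (_⇔_)
open import Level using (Level; _⊔_; 0ℓ) renaming (suc to lsuc)
open import Relation.Binary.Bundles using (Setoid)
open import Relation.Binary.Construct.Closure.ReflexiveTransitive using (Star)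
open import Relation.Binary.PropositionalEquality.Core using (_≡_; _≢_)
open import Relation.Nullary.Negation.Core using (¬_)
open import Relation.Unary using (Pred; _⊆_; _∪_)

record Signature : Set₁ where
  field
    Fun         : Set
    Rel         : Set
    funArity    : Fun → ℕ
    relArity    : Rel → ℕ
    hasConstant : ∃[ f ] funArity f ≡ 0

data Polarity : Set where
  input output : Polarity

module LogicPrograms (S : Signature) where

  open Signature S

  -- Expressions are over an arbitrary set V of variables: V = ℕ for programs and
  -- queries, V = ⊥ for ground expressions.

  data Term (V : Set) : Set where
    var : V → Term V
    fn  : (f : Fun) → Vec (Term V) (funArity f) → Term V

  infix 8 _$_
  record Atom (V : Set) : Set where
    constructor _$_
    field
      rel  : Rel
      args : Vec (Term V) (relArity rel)
  open Atom public

  data Literal (V : Set) : Set where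
    pos neg : Atom V → Literal V

  atomOf : ∀ {V} → Literal V → Atom V
  atomOf (pos A) = A
  atomOf (neg A) = A

  Body : Set → Set
  Body V = List (Literal V)

  infix 4 _←_
  record Clause (V : Set) : Set where
    constructor _←_
    field
      head : Atom V
      body : Body V
  open Clause public

  Query : Set
  Query = Body ℕ

  Program : Set
  Program = List (Clause ℕ)

  infix 4 _∈Var_
  data _∈Var_ {V : Set} (x : V) : Term V → Set where
    here  : x ∈Var var x
    there : ∀ {f ts} → VecAny.Any (x ∈Var_) ts → x ∈Var fn f ts

  VarAtom : ∀ {V} → Atom V → Pred V 0ℓ
  VarAtom A x = VecAny.Any (x ∈Var_) (args A)

  VarBody : ∀ {V} → Body V → Pred V 0ℓ
  VarBody Q x = Any (λ L → VarAtom (atomOf L) x) Q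

  VarClause : ∀ {V} → Clause V → Pred V 0ℓ
  VarClause C = VarAtom (head C) ∪ VarBody (body C)

  Ground : ∀ {V} → Atom V → Set
  Ground A = ∀ x → ¬ VarAtom A x

  module _ {V W : Set} where

    mutual
      substTerm : (V → Term W) → Term V → Term W
      substTerm σ (var x)   = σ x
      substTerm σ (fn f ts) = fn f (substTerms σ ts)

      substTerms : ∀ {n} → (V → Term W) → Vec (Term V) n → Vec (Term W) n
      substTerms σ []       = []
      substTerms σ (t ∷ ts) = substTerm σ t ∷ substTerms σ ts

    substAtom : (V → Term W) → Atom V → Atom W
    substAtom σ (p $ ts) = p $ substTerms σ ts

    substLiteral : (V → Term W) → Literal V → Literal W
    substLiteral σ (pos A) = pos (substAtom σ A)
    substLiteral σ (neg A) = neg (substAtom σ A)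

    substBody : (V → Term W) → Body V → Body W
    substBody σ = map (substLiteral σ)

    substClause : (V → Term W) → Clause V → Clause W
    substClause σ (H ← Q) = substAtom σ H ← substBody σ Q

  record Substitution : Set where
    field
      fun           : ℕ → Term ℕ
      finiteSupport : ∃[ n ] (∀ x → n ≤ x → fun x ≡ var x)
  open Substitution public

  Variant : Clause ℕ → Clause ℕ → Set
  Variant C D = (∃[ σ ] C ≡ substClause (fun σ) D) × (∃[ σ ] D ≡ substClause (fun σ) C)

  Unifier : Substitution → Atom ℕ → Atom ℕ → Set
  Unifier θ A B = substAtom (fun θ) A ≡ substAtom (fun θ) B

  MGU : Substitution → Atom ℕ → Atom ℕ → Set
  MGU θ A B =
      Unifier θ A B
    × (∀ σ → Unifier σ A B → ∃[ γ ] (∀ x → fun σ x ≡ substTerm (fun γ) (fun θ x)))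

  RenamedApart : Clause ℕ → Query → Set
  RenamedApart C Q = ∀ x → VarClause C x → ¬ VarBody Q x

  infix 3 _⊢_⟶⁺_ _⊢_⟶_ _⊢_↝_

  data _⊢_⟶⁺_ (P : Program) : Query → Query → Set where
    resolve : ∀ {A 𝐋 C H 𝐁 θ} →
              C ∈ P → Variant (H ← 𝐁) C → RenamedApart (H ← 𝐁) (pos A ∷ 𝐋) →
              MGU θ A H →
              P ⊢ pos A ∷ 𝐋 ⟶⁺ substBody (fun θ) (𝐁 ++ 𝐋)

  -- Finite LDNF-trees.  A node with a positive first literal has a child for
  -- every choice of renamed clause and mgu; these choices differ only up to
  -- variants, so well-foundedness of Tree amounts to finiteness.  A subsidiary
  -- tree that is finite but neither finitely failed nor successful (because it
  -- flounders) leaves its node without resolvents and without being failed.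
  mutual
    data Tree (P : Program) : Query → Set where
      empty    : Tree P []
      positive : ∀ {A 𝐋} →
                 (∀ {Q} → P ⊢ pos A ∷ 𝐋 ⟶⁺ Q → Tree P Q) →
                 Tree P (pos A ∷ 𝐋)
      flounder : ∀ {A 𝐋} → ¬ Ground A → Tree P (neg A ∷ 𝐋)
      negStep  : ∀ {A 𝐋} → Ground A →
                 (T : Tree P [ pos A ]) → FinitelyFailed T →
                 Tree P 𝐋 → Tree P (neg A ∷ 𝐋)
      negLeaf  : ∀ {A 𝐋} → Ground A →
                 (T : Tree P [ pos A ]) → ¬ FinitelyFailed T →
                 Tree P (neg A ∷ 𝐋)

    -- All branches are failed.
    FinitelyFailed : ∀ {P Q} → Tree P Q → Set
    FinitelyFailed empty                       = ⊥
    FinitelyFailed (positive {A} {𝐋} children) =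
      ∀ {Q} (r : _ ⊢ pos A ∷ 𝐋 ⟶⁺ Q) → FinitelyFailed (children r)
    FinitelyFailed (flounder _)                = ⊥
    FinitelyFailed (negStep _ _ _ U)           = FinitelyFailed U
    FinitelyFailed (negLeaf _ T _)             = Successful T

    -- Some branch is successful.
    Successful : ∀ {P Q} → Tree P Q → Set
    Successful empty                 = ⊤
    Successful (positive {A} {𝐋} children) =
      ∃[ Q ] Σ (_ ⊢ pos A ∷ 𝐋 ⟶⁺ Q) λ r → Successful (children r)
    Successful (flounder _)          = ⊥
    Successful (negStep _ _ _ U)     = Successful U
    Successful (negLeaf _ _ _)       = ⊥

  data _⊢_⟶_ (P : Program) : Query → Query → Set where
    positive : ∀ {Q Q′} → P ⊢ Q ⟶⁺ Q′ → P ⊢ Q ⟶ Q′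
    negative : ∀ {A 𝐋} → Ground A → (T : Tree P [ pos A ]) → FinitelyFailed T →
               P ⊢ neg A ∷ 𝐋 ⟶ 𝐋

  data _⊢_↝_ (P : Program) : Query → Query → Set where
    resolvent  : ∀ {Q Q′} → P ⊢ Q ⟶ Q′ → P ⊢ Q ↝ Q′
    subsidiary : ∀ {A 𝐋} → Ground A → P ⊢ neg A ∷ 𝐋 ↝ [ pos A ]

  AllDerivationsFinite : Program → Query → Set
  AllDerivationsFinite P Q =
    ¬ (Σ (ℕ → Query) λ Qs → Qs 0 ≡ Q × (∀ k → P ⊢ Qs k ↝ Qs (suc k)))

  Defined : Program → Pred Rel 0ℓ
  Defined P p = Any (λ C → rel (head C) ≡ p) P

  OccursInBody : ∀ {V} → Body V → Pred Rel 0ℓ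
  OccursInBody Q p = Any (λ L → rel (atomOf L) ≡ p) Q

  Occurs : Program → Pred Rel 0ℓ
  Occurs P = Defined P ∪ (λ p → Any (λ C → OccursInBody (body C) p) P)

  infix 4 _Extends_
  _Extends_ : Program → Program → Set
  P Extends R = ∀ p → Defined P p → ¬ Occurs R p

  RefersTo : Program → Rel → Rel → Set
  RefersTo P p q = Any (λ C → rel (head C) ≡ p × OccursInBody (body C) q) P

  DependsOn : Program → Rel → Rel → Set
  DependsOn P = Star (RefersTo P)

  Neg : Program → Pred Rel 0ℓ
  Neg P p = ∃[ C ] C ∈ P × (∃[ ts ] neg (p $ ts) ∈ body C)

  Neg* : Program → Pred Rel 0ℓ
  Neg* P q = ∃[ p ] Neg P p × DependsOn P p q

  infix 4 _∈_⁻
  _∈_⁻ : Clause ℕ → Program → Set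
  C ∈ P ⁻ = C ∈ P × Neg* P (rel (head C))

  Moding : Set
  Moding = (p : Rel) → Fin (relArity p) → Polarity

  module _ (m : Moding) where

    VarAt : Polarity → ∀ {V} → Atom V → Pred V 0ℓ
    VarAt d (p $ ts) x = ∃[ i ] m p i ≡ d × x ∈Var lookup ts i

    In Out : ∀ {V} → Atom V → Pred V 0ℓ
    In  = VarAt input
    Out = VarAt output

    OutBody : ∀ {V} → Body V → Pred V 0ℓ
    OutBody Q x = Any (λ L → Out (atomOf L) x) Q

    WellModedQuery : Query → Set
    WellModedQuery Q =
      ∀ {𝐀 L 𝐁} → Q ≡ 𝐀 ++ L ∷ 𝐁 → In (atomOf L) ⊆ OutBody 𝐀

    WellModedClause : Clause ℕ → Set
    WellModedClause (H ← Q) =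
        (∀ {𝐀 L 𝐁} → Q ≡ 𝐀 ++ L ∷ 𝐁 → In (atomOf L) ⊆ In H ∪ OutBody 𝐀)
      × Out H ⊆ In H ∪ OutBody Q

    WellModedProgram : Program → Set
    WellModedProgram = All WellModedClause

  record Base (P : Program) : Set where
    constructor base
    field
      atom    : Atom ⊥
      .occurs : Occurs P (rel atom)
  open Base public

  LevelMapping : Program → Set
  LevelMapping P = Base P → ℕ

  Moded : Moding → ∀ {P} → LevelMapping P → Set
  Moded m {P} ∣_∣ =
    ∀ {p ts us} .(o : Occurs P p) →
    (∀ i → m p i ≡ input → lookup ts i ≡ lookup us i) →
    ∣ base (p $ ts) o ∣ ≡ ∣ base (p $ us) o ∣

  -- Interpretations are not necessarily Herbrand.  The equality symbol of the
  -- completion denotes the equality of the domain setoid.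

  record Interpretation (c ℓ r : Level) : Set (lsuc (c ⊔ ℓ ⊔ r)) where
    field
      domain : Setoid c ℓ
    open Setoid domain public using (_≈_) renaming (Carrier to D)
    field
      ⟦_⟧ᶠ  : (f : Fun) → Vec D (funArity f) → D
      ⟦_⟧ʳ  : (p : Rel) → Vec D (relArity p) → Set r
      cong  : ∀ f {ds es} → Pointwise _≈_ ds es → ⟦ f ⟧ᶠ ds ≈ ⟦ f ⟧ᶠ es
      resp  : ∀ p {ds es} → Pointwise _≈_ ds es → ⟦ p ⟧ʳ ds → ⟦ p ⟧ʳ es

    module _ {V : Set} where

      mutual
        eval : (V → D) → Term V → D
        eval ρ (var x)   = ρ x
        eval ρ (fn f ts) = ⟦ f ⟧ᶠ (evals ρ ts)

        evals : ∀ {n} → (V → D) → Vec (Term V) n → Vec D n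
        evals ρ []       = []
        evals ρ (t ∷ ts) = eval ρ t ∷ evals ρ ts

      ⊨Atom : (V → D) → Atom V → Set r
      ⊨Atom ρ (p $ ts) = ⟦ p ⟧ʳ (evals ρ ts)

      ⊨Literal : (V → D) → Literal V → Set r
      ⊨Literal ρ (pos A) = ⊨Atom ρ A
      ⊨Literal ρ (neg A) = ¬ ⊨Atom ρ A

      ⊨Body : (V → D) → Body V → Set r
      ⊨Body ρ = All (⊨Literal ρ)

  module _ {c ℓ r} (M : Interpretation c ℓ r) where

    open Interpretation M

    ⊨Ground : Body ⊥ → Set r
    ⊨Ground = ⊨Body (λ ())

    Model : Program → Set (c ⊔ r)
    Model P = ∀ {C} → C ∈ P → ∀ ρ → ⊨Body ρ (body C) → ⊨Atom ρ (head C)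

    record FreeEquality : Set (c ⊔ ℓ) where
      field
        injective : ∀ f {ds es} → ⟦ f ⟧ᶠ ds ≈ ⟦ f ⟧ᶠ es → Pointwise _≈_ ds es
        distinct  : ∀ {f g} → f ≢ g → ∀ ds es → ¬ ⟦ f ⟧ᶠ ds ≈ ⟦ g ⟧ᶠ es
        acyclic   : ∀ {x : ℕ} {t} → x ∈Var t → t ≢ var x → ∀ ρ → ¬ eval ρ t ≈ ρ x

    -- p(𝐱) ↔ ⋁ ∃𝐲 (𝐱 = 𝐭 ∧ 𝐋), the disjunction ranging over the clauses
    -- p(𝐭) ← 𝐋 of P⁻; it is empty, hence false, if p has no clauses.
    CompletedDefinition : Program → Rel → Set (c ⊔ ℓ ⊔ r)
    CompletedDefinition P p =
      ∀ ds → ⟦ p ⟧ʳ ds ⇔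
             (∃[ ts ] ∃[ 𝐋 ] (p $ ts ← 𝐋) ∈ P ⁻ ×
               (∃[ ρ ] Pointwise _≈_ ds (evals ρ ts) × ⊨Body ρ 𝐋))

    record CompleteModel (P : Program) : Set (c ⊔ ℓ ⊔ r) where
      field
        model        : Model P
        freeEquality : FreeEquality
        completion   : ∀ {p} → Neg* P p → CompletedDefinition P p

  infix 4 _∈ground_
  _∈ground_ : Clause ⊥ → Program → Set
  C ∈ground P = ∃[ C₀ ] C₀ ∈ P × (∃[ σ ] C ≡ substClause σ C₀)

  -- B is the atom of the literal L, so that ∣ B ∣ is the level of L.
  Acceptable : ∀ {c ℓ r} (P : Program) → LevelMapping P → Interpretation c ℓ r → Set r
  Acceptable P ∣_∣ M =
    ∀ {A B : Base P} {𝐀 L 𝐁} →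
    (atom A ← 𝐀 ++ L ∷ 𝐁) ∈ground P → atom B ≡ atomOf L →
    ⊨Ground M 𝐀 → ∣ A ∣ > ∣ B ∣

-- Suppose first that A is a called atom defined in P.  Well-modedness makes its input
-- terms ground, so its moded level is the same for all ground instances.  Resolving A
-- yields a body whose literals defined in P have smaller level whenever the literals
-- before them are true in M, and a literal that has been resolved away is true in M
-- under the computed substitution (for a negative literal because M satisfies the
-- completion).  Hence, by induction on the level and then on the length of the body,
-- an infinite derivation has to resolve away the whole body and to continue with the
-- rest of the query.  The same holds for an atom not defined in P, because a derivation
-- that never resolves it away restricts to an infinite derivation of R.  So literals
-- can be peeled off an arbitrary well-moded query one by one.
--
-- Finiteness of derivations is a negation, so excluded middle is available for each
-- single case distinction.

module Submission where

open import Defs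
open import Data.Empty using (⊥; ⊥-elim)
open import Data.Fin.Base using (zero; suc)
open import Data.List.Base using (List; []; _∷_; [_]; _++_; map; length; filter; upTo)
open import Data.List.Membership.Propositional using (_∈_; lose)
open import Data.List.Membership.Propositional.Properties using (∈-filter⁺; ∈-upTo⁺; ∈-++⁺ʳ; ∈-++⁻)
open import Data.List.Properties using (length-map; map-++; map-∘; map-cong; map-id; filter-notAll; ++-assoc)
open import Data.List.Relation.Unary.All using (All; []; _∷_)
import Data.List.Relation.Unary.All as All
import Data.List.Relation.Unary.All.Properties as All
open import Data.List.Relation.Unary.Any using (Any; here; there)
import Data.List.Relation.Unary.Any as Any
import Data.List.Relation.Unary.Any.Properties as Any
open import Data.Nat.Base using (ℕ; zero; suc; _+_; _∸_; _≤_; _<_; _⊔_; s≤s)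
open import Data.Nat.Properties
open import Data.Product.Base using (Σ; ∃-syntax; _×_; _,_; proj₁; proj₂)
import Data.Product.Base as Product
open import Data.Sum.Base using (_⊎_; inj₁; inj₂; [_,_]′)
open import Data.Unit.Base using (⊤; tt)
open import Data.Vec.Base using (Vec; []; _∷_; lookup)
open import Data.Vec.Properties using (∷-injective)
import Data.Vec.Relation.Unary.Any as VecAny
open import Data.Vec.Relation.Binary.Pointwise.Inductive using (Pointwise; []; _∷_)
import Data.Vec.Relation.Binary.Pointwise.Inductive as Pointwise
open import Function.Base using (_∘_; id)
open import Function.Bundles using (Equivalence)
open import Level using (0ℓ)
open import Relation.Binary.Bundles using (Setoid)
open import Relation.Binary.Construct.Closure.ReflexiveTransitive using (ε; _◅_; _◅◅_)
open import Relation.Binary.PropositionalEquality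
  using (_≡_; _≢_; refl; sym; trans; cong; cong₂; subst)
open import Relation.Nullary using (¬_; Dec; yes; no; ¬?; contradiction)
open import Relation.Nullary.Decidable using (¬¬-excluded-middle)
open import Relation.Unary using (Pred; _⊆_; _∪_; ∅)

-- Substitutions and the variables of expressions.

module Terms (S : Signature) where

  open Signature S
  open LogicPrograms S

  infixr 9 _⊙_
  _⊙_ : ∀ {U V W : Set} → (V → Term W) → (U → Term V) → U → Term W
  (τ ⊙ σ) x = substTerm τ (σ x)

  module _ {V W : Set} {σ τ : V → Term W} where

    mutual
      substTerm-local : ∀ t → (∀ {x} → x ∈Var t → σ x ≡ τ x) → substTerm σ t ≡ substTerm τ t
      substTerm-local (var x)   σ≡τ = σ≡τ here
      substTerm-local (fn f ts) σ≡τ = cong (fn f) (substTerms-local ts (σ≡τ ∘ there))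

      substTerms-local : ∀ {n} (ts : Vec (Term V) n) →
                         (∀ {x} → VecAny.Any (x ∈Var_) ts → σ x ≡ τ x) →
                         substTerms σ ts ≡ substTerms τ ts
      substTerms-local []       _   = refl
      substTerms-local (t ∷ ts) σ≡τ =
        cong₂ _∷_ (substTerm-local t (σ≡τ ∘ VecAny.here)) (substTerms-local ts (σ≡τ ∘ VecAny.there))

  module _ {V : Set} where

    mutual
      substTerm-var : (t : Term V) → substTerm var t ≡ t
      substTerm-var (var x)   = refl
      substTerm-var (fn f ts) = cong (fn f) (substTerms-var ts)

      substTerms-var : ∀ {n} (ts : Vec (Term V) n) → substTerms var ts ≡ ts
      substTerms-var []       = refl
      substTerms-var (t ∷ ts) = cong₂ _∷_ (substTerm-var t) (substTerms-var ts)

    substAtom-var : (A : Atom V) → substAtom var A ≡ A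
    substAtom-var (p $ ts) = cong (p $_) (substTerms-var ts)

    substLiteral-var : (L : Literal V) → substLiteral var L ≡ L
    substLiteral-var (pos A) = cong pos (substAtom-var A)
    substLiteral-var (neg A) = cong neg (substAtom-var A)

    substBody-var : (Q : Body V) → substBody var Q ≡ Q
    substBody-var Q = trans (map-cong substLiteral-var Q) (map-id Q)

  module _ {U V W : Set} (τ : V → Term W) (σ : U → Term V) where

    mutual
      substTerm-⊙ : ∀ t → substTerm τ (substTerm σ t) ≡ substTerm (τ ⊙ σ) t
      substTerm-⊙ (var x)   = refl
      substTerm-⊙ (fn f ts) = cong (fn f) (substTerms-⊙ ts)

      substTerms-⊙ : ∀ {n} (ts : Vec (Term U) n) →
                     substTerms τ (substTerms σ ts) ≡ substTerms (τ ⊙ σ) ts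
      substTerms-⊙ []       = refl
      substTerms-⊙ (t ∷ ts) = cong₂ _∷_ (substTerm-⊙ t) (substTerms-⊙ ts)

    substAtom-⊙ : ∀ A → substAtom τ (substAtom σ A) ≡ substAtom (τ ⊙ σ) A
    substAtom-⊙ (p $ ts) = cong (p $_) (substTerms-⊙ ts)

    substLiteral-⊙ : ∀ L → substLiteral τ (substLiteral σ L) ≡ substLiteral (τ ⊙ σ) L
    substLiteral-⊙ (pos A) = cong pos (substAtom-⊙ A)
    substLiteral-⊙ (neg A) = cong neg (substAtom-⊙ A)

    substBody-⊙ : ∀ Q → substBody τ (substBody σ Q) ≡ substBody (τ ⊙ σ) Q
    substBody-⊙ Q = trans (sym (map-∘ Q)) (map-cong substLiteral-⊙ Q)

    substClause-⊙ : ∀ C → substClause τ (substClause σ C) ≡ substClause (τ ⊙ σ) C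
    substClause-⊙ (H ← Q) = cong₂ _←_ (substAtom-⊙ H) (substBody-⊙ Q)

  atomOf-subst : ∀ {V W} (σ : V → Term W) L → atomOf (substLiteral σ L) ≡ substAtom σ (atomOf L)
  atomOf-subst σ (pos A) = refl
  atomOf-subst σ (neg A) = refl

  rel-subst : ∀ {V W} (σ : V → Term W) L → rel (atomOf (substLiteral σ L)) ≡ rel (atomOf L)
  rel-subst σ (pos A) = refl
  rel-subst σ (neg A) = refl

  All-rel-subst : ∀ {ℓ V W} {X : Rel → Set ℓ} (σ : V → Term W) {Q : Body V} →
                  All (X ∘ rel ∘ atomOf) Q → All (X ∘ rel ∘ atomOf) (substBody σ Q)
  All-rel-subst {X = X} σ = All.gmap⁺ λ {L} → subst X (sym (rel-subst σ L))

  module _ {V W : Set} {σ : V → Term W} where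

    mutual
      ∈Var-subst⁻ : ∀ t {y} → y ∈Var substTerm σ t → ∃[ x ] x ∈Var t × y ∈Var σ x
      ∈Var-subst⁻ (var x)   y∈ = x , here , y∈
      ∈Var-subst⁻ (fn f ts) (there y∈) with ∈Vars-subst⁻ ts y∈
      ... | x , x∈ , y∈σx = x , there x∈ , y∈σx

      ∈Vars-subst⁻ : ∀ {n} (ts : Vec (Term V) n) {y} → VecAny.Any (y ∈Var_) (substTerms σ ts) →
                     ∃[ x ] VecAny.Any (x ∈Var_) ts × y ∈Var σ x
      ∈Vars-subst⁻ (t ∷ ts) (VecAny.here y∈) with ∈Var-subst⁻ t y∈
      ... | x , x∈ , y∈σx = x , VecAny.here x∈ , y∈σx
      ∈Vars-subst⁻ (t ∷ ts) (VecAny.there y∈) with ∈Vars-subst⁻ ts y∈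
      ... | x , x∈ , y∈σx = x , VecAny.there x∈ , y∈σx

    mutual
      ∈Var-subst⁺ : ∀ {t x y} → x ∈Var t → y ∈Var σ x → y ∈Var substTerm σ t
      ∈Var-subst⁺ here       y∈ = y∈
      ∈Var-subst⁺ (there x∈) y∈ = there (∈Vars-subst⁺ x∈ y∈)

      ∈Vars-subst⁺ : ∀ {n} {ts : Vec (Term V) n} {x y} → VecAny.Any (x ∈Var_) ts → y ∈Var σ x →
                     VecAny.Any (y ∈Var_) (substTerms σ ts)
      ∈Vars-subst⁺ (VecAny.here x∈)  y∈ = VecAny.here (∈Var-subst⁺ x∈ y∈)
      ∈Vars-subst⁺ (VecAny.there x∈) y∈ = VecAny.there (∈Vars-subst⁺ x∈ y∈)

    lookup-substTerms : ∀ {n} (ts : Vec (Term V) n) i →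
                        lookup (substTerms σ ts) i ≡ substTerm σ (lookup ts i)
    lookup-substTerms (t ∷ ts) zero    = refl
    lookup-substTerms (t ∷ ts) (suc i) = lookup-substTerms ts i

    VarLiteral-subst⁻ : ∀ L {y} → VarAtom (atomOf (substLiteral σ L)) y →
                        ∃[ x ] VarAtom (atomOf L) x × y ∈Var σ x
    VarLiteral-subst⁻ (pos (p $ ts)) = ∈Vars-subst⁻ ts
    VarLiteral-subst⁻ (neg (p $ ts)) = ∈Vars-subst⁻ ts

    VarBody-subst⁻ : ∀ Q {y} → VarBody (substBody σ Q) y → ∃[ x ] VarBody Q x × y ∈Var σ x
    VarBody-subst⁻ (L ∷ Q) (here y∈)  = Product.map₂ (Product.map₁ here) (VarLiteral-subst⁻ L y∈)
    VarBody-subst⁻ (L ∷ Q) (there y∈) = Product.map₂ (Product.map₁ there) (VarBody-subst⁻ Q y∈)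

  lookup-Any : ∀ {V : Set} {n} (ts : Vec (Term V) n) i {x} → x ∈Var lookup ts i →
               VecAny.Any (x ∈Var_) ts
  lookup-Any (t ∷ ts) zero    x∈ = VecAny.here x∈
  lookup-Any (t ∷ ts) (suc i) x∈ = VecAny.there (lookup-Any ts i x∈)


-- Evaluation under assignments and the substitution lemma.

module Semantics (S : Signature) {c ℓ r} (M : LogicPrograms.Interpretation S c ℓ r) where

  open LogicPrograms S
  open Interpretation M renaming (cong to ⟦⟧ᶠ-cong)
  open Setoid domain using () renaming (sym to ≈-sym)
  open Terms S

  module _ {V : Set} {ρ ρ′ : V → D} where

    mutual
      eval-local : ∀ t → (∀ {x} → x ∈Var t → ρ x ≈ ρ′ x) → eval ρ t ≈ eval ρ′ t
      eval-local (var x)   ρ≈ρ′ = ρ≈ρ′ here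
      eval-local (fn f ts) ρ≈ρ′ = ⟦⟧ᶠ-cong f (evals-local ts (ρ≈ρ′ ∘ there))

      evals-local : ∀ {n} (ts : Vec (Term V) n) → (∀ {x} → VecAny.Any (x ∈Var_) ts → ρ x ≈ ρ′ x) →
                    Pointwise _≈_ (evals ρ ts) (evals ρ′ ts)
      evals-local []       _    = []
      evals-local (t ∷ ts) ρ≈ρ′ =
        eval-local t (ρ≈ρ′ ∘ VecAny.here) ∷ evals-local ts (ρ≈ρ′ ∘ VecAny.there)

    ⊨Atom-local : ∀ A → (∀ {x} → VarAtom A x → ρ x ≈ ρ′ x) → ⊨Atom ρ A → ⊨Atom ρ′ A
    ⊨Atom-local (p $ ts) ρ≈ρ′ = resp p (evals-local ts ρ≈ρ′)

  module _ {V : Set} {ρ ρ′ : V → D} where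

    ⊨Literal-local : ∀ L → (∀ {x} → VarAtom (atomOf L) x → ρ x ≈ ρ′ x) → ⊨Literal ρ L → ⊨Literal ρ′ L
    ⊨Literal-local (pos A) ρ≈ρ′ ⊨A = ⊨Atom-local A ρ≈ρ′ ⊨A
    ⊨Literal-local (neg A) ρ≈ρ′ ⊭A = ⊭A ∘ ⊨Atom-local A (≈-sym ∘ ρ≈ρ′)

    ⊨Body-local : ∀ Q → (∀ {x} → VarBody Q x → ρ x ≈ ρ′ x) → ⊨Body ρ Q → ⊨Body ρ′ Q
    ⊨Body-local []      _    []         = []
    ⊨Body-local (L ∷ Q) ρ≈ρ′ (⊨L ∷ ⊨Q) =
      ⊨Literal-local L (ρ≈ρ′ ∘ here) ⊨L ∷ ⊨Body-local Q (ρ≈ρ′ ∘ there) ⊨Q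

  infixl 9 _★_
  _★_ : ∀ {V W : Set} → (W → D) → (V → Term W) → V → D
  (ρ ★ σ) x = eval ρ (σ x)

  module _ {V W : Set} {ρ : W → D} {σ : V → Term W} where

    mutual
      eval-subst : ∀ t → eval ρ (substTerm σ t) ≡ eval (ρ ★ σ) t
      eval-subst (var x)   = refl
      eval-subst (fn f ts) = cong ⟦ f ⟧ᶠ (evals-subst ts)

      evals-subst : ∀ {n} (ts : Vec (Term V) n) → evals ρ (substTerms σ ts) ≡ evals (ρ ★ σ) ts
      evals-subst []       = refl
      evals-subst (t ∷ ts) = cong₂ _∷_ (eval-subst t) (evals-subst ts)

    ⊨Literal-subst : ∀ L → ⊨Literal ρ (substLiteral σ L) ≡ ⊨Literal (ρ ★ σ) L
    ⊨Literal-subst (pos (p $ ts)) = cong ⟦ p ⟧ʳ (evals-subst ts)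
    ⊨Literal-subst (neg (p $ ts)) = cong (¬_ ∘ ⟦ p ⟧ʳ) (evals-subst ts)

    ⊨Literal-subst⁻ : ∀ L → ⊨Literal ρ (substLiteral σ L) → ⊨Literal (ρ ★ σ) L
    ⊨Literal-subst⁻ L = subst id (⊨Literal-subst L)

    ⊨Literal-subst⁺ : ∀ L → ⊨Literal (ρ ★ σ) L → ⊨Literal ρ (substLiteral σ L)
    ⊨Literal-subst⁺ L = subst id (sym (⊨Literal-subst L))

    ⊨Body-subst⁻ : ∀ Q → ⊨Body ρ (substBody σ Q) → ⊨Body (ρ ★ σ) Q
    ⊨Body-subst⁻ Q = All.gmap⁻ λ {L} → ⊨Literal-subst⁻ L

    ⊨Body-subst⁺ : ∀ Q → ⊨Body (ρ ★ σ) Q → ⊨Body ρ (substBody σ Q)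
    ⊨Body-subst⁺ Q = All.gmap⁺ λ {L} → ⊨Literal-subst⁺ L

-- Well-modedness and its preservation under resolution.

module Modes (S : Signature) (m : LogicPrograms.Moding S) where

  open LogicPrograms S
  open Terms S

  module _ {d : Polarity} {V W : Set} {σ : V → Term W} where

    VarAt-subst⁻ : ∀ A {y} → VarAt m d (substAtom σ A) y → ∃[ x ] VarAt m d A x × y ∈Var σ x
    VarAt-subst⁻ (p $ ts) (i , eq , y∈)
      with ∈Var-subst⁻ (lookup ts i) (subst (_ ∈Var_) (lookup-substTerms ts i) y∈)
    ... | x , x∈ , y∈σx = x , (i , eq , x∈) , y∈σx

    VarAt-subst⁺ : ∀ A {x y} → VarAt m d A x → y ∈Var σ x → VarAt m d (substAtom σ A) y
    VarAt-subst⁺ (p $ ts) (i , eq , x∈) y∈ =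
      i , eq , subst (_ ∈Var_) (sym (lookup-substTerms ts i)) (∈Var-subst⁺ x∈ y∈)

    VarAt-substLiteral⁻ : ∀ L {y} → VarAt m d (atomOf (substLiteral σ L)) y →
                          ∃[ x ] VarAt m d (atomOf L) x × y ∈Var σ x
    VarAt-substLiteral⁻ (pos A) = VarAt-subst⁻ A
    VarAt-substLiteral⁻ (neg A) = VarAt-subst⁻ A

    VarAt-substLiteral⁺ : ∀ L {x y} → VarAt m d (atomOf L) x → y ∈Var σ x →
                          VarAt m d (atomOf (substLiteral σ L)) y
    VarAt-substLiteral⁺ (pos A) = VarAt-subst⁺ A
    VarAt-substLiteral⁺ (neg A) = VarAt-subst⁺ A

  VarAt⊆VarAtom : ∀ {d} {V : Set} (A : Atom V) → VarAt m d A ⊆ VarAtom A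
  VarAt⊆VarAtom (p $ ts) (i , _ , x∈) = lookup-Any ts i x∈

  Image : ∀ {V W : Set} → (V → Term W) → Pred V 0ℓ → Pred W 0ℓ
  Image σ X y = ∃[ x ] X x × y ∈Var σ x

  OutBody-subst⁺ : ∀ {σ : ℕ → Term ℕ} Q → Image σ (OutBody m Q) ⊆ OutBody m (substBody σ Q)
  OutBody-subst⁺ (L ∷ Q) (x , here x∈ , y∈)  = here (VarAt-substLiteral⁺ L x∈ y∈)
  OutBody-subst⁺ (L ∷ Q) (x , there x∈ , y∈) = there (OutBody-subst⁺ Q (x , x∈ , y∈))

  OutBody-∷ : ∀ (X : Pred ℕ 0ℓ) L Q → X ∪ OutBody m (L ∷ Q) ⊆ (X ∪ Out m (atomOf L)) ∪ OutBody m Q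
  OutBody-∷ X L Q (inj₁ x∈)         = inj₁ (inj₁ x∈)
  OutBody-∷ X L Q (inj₂ (here x∈))  = inj₁ (inj₂ x∈)
  OutBody-∷ X L Q (inj₂ (there x∈)) = inj₂ x∈

  -- The variables of X are regarded as already instantiated when Q is called.
  WellModedFrom : Pred ℕ 0ℓ → Query → Set
  WellModedFrom X []      = ⊤
  WellModedFrom X (L ∷ Q) = In m (atomOf L) ⊆ X × WellModedFrom (X ∪ Out m (atomOf L)) Q

  WellModedFrom⁺ : ∀ {X} Q → (∀ {𝐀 L 𝐁} → Q ≡ 𝐀 ++ L ∷ 𝐁 → In m (atomOf L) ⊆ X ∪ OutBody m 𝐀) →
                   WellModedFrom X Q
  WellModedFrom⁺ []      _ = tt
  WellModedFrom⁺ {X} (L ∷ Q) h =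
    (λ x∈ → [ id , (λ ()) ]′ (h {[]} refl x∈)) ,
    WellModedFrom⁺ Q λ { {𝐀} refl x∈ → OutBody-∷ X L 𝐀 (h {L ∷ 𝐀} refl x∈) }

  WellModedFrom-mono : ∀ {X Y} Q → X ⊆ Y → WellModedFrom X Q → WellModedFrom Y Q
  WellModedFrom-mono []      _   _         = tt
  WellModedFrom-mono (L ∷ Q) X⊆Y (wl , wq) =
    X⊆Y ∘ wl , WellModedFrom-mono Q [ inj₁ ∘ X⊆Y , inj₂ ]′ wq

  WellModedFrom-subst : ∀ {X} (σ : ℕ → Term ℕ) Q →
                        WellModedFrom X Q → WellModedFrom (Image σ X) (substBody σ Q)
  WellModedFrom-subst σ []      _         = tt
  WellModedFrom-subst {X} σ (L ∷ Q) (wl , wq) =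
    (λ y∈ → Product.map₂ (Product.map₁ wl) (VarAt-substLiteral⁻ L y∈)) ,
    WellModedFrom-mono (substBody σ Q) split (WellModedFrom-subst σ Q wq)
    where
    split : Image σ (X ∪ Out m (atomOf L)) ⊆ Image σ X ∪ Out m (atomOf (substLiteral σ L))
    split (x , inj₁ x∈ , y∈) = inj₁ (x , x∈ , y∈)
    split (x , inj₂ x∈ , y∈) = inj₂ (VarAt-substLiteral⁺ L x∈ y∈)

  WellModedFrom-++ : ∀ {X} 𝐁 {𝐋} → WellModedFrom X 𝐁 → WellModedFrom (X ∪ OutBody m 𝐁) 𝐋 →
                     WellModedFrom X (𝐁 ++ 𝐋)
  WellModedFrom-++ []      {𝐋} _         wl = WellModedFrom-mono 𝐋 [ id , (λ ()) ]′ wl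
  WellModedFrom-++ {X} (L ∷ 𝐁) {𝐋} (w , wb) wl =
    w , WellModedFrom-++ 𝐁 wb (WellModedFrom-mono 𝐋 (OutBody-∷ X L 𝐁) wl)

  WellModed : Query → Set
  WellModed = WellModedFrom ∅

  wellModed-literal : ∀ {L 𝐋} → WellModed (L ∷ 𝐋) → WellModed [ L ]
  wellModed-literal (wl , _) = wl , tt

  wellModedQuery-literal : ∀ {L} → WellModed [ L ] → WellModedQuery m [ L ]
  wellModedQuery-literal (wl , _) {[]}         refl x∈ = ⊥-elim (wl x∈)
  wellModedQuery-literal (wl , _) {_ ∷ []}     ()
  wellModedQuery-literal (wl , _) {_ ∷ _ ∷ _}  ()

  -- A ground atom has no output variables, so the literals after it lose nothing when it is
  -- removed.
  wellModed-negative : ∀ {A 𝐋} → Ground A → WellModed (neg A ∷ 𝐋) → WellModed 𝐋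
  wellModed-negative {A} {𝐋} ground (_ , wl) =
    WellModedFrom-mono 𝐋 [ id , ground _ ∘ VarAt⊆VarAtom A ]′ wl

  -- The atom `A` comes first, so its input terms, and with them those of `Hθ`, are ground; thus
  -- `𝐁θ` needs no variables from outside. The outputs of `Aθ` that `𝐋θ` may consume are produced by
  -- `𝐁θ` instead.
  wellModed-resolvent : ∀ {P A 𝐋 C H 𝐁} {θ : ℕ → Term ℕ} → WellModedProgram m P →
                        C ∈ P → Variant (H ← 𝐁) C → substAtom θ A ≡ substAtom θ H →
                        WellModed (pos A ∷ 𝐋) → WellModed (substBody θ (𝐁 ++ 𝐋))
  wellModed-resolvent {P} {A} {𝐋} {H₀ ← 𝐁₀} {θ = θ} wP C∈P ((σ , refl) , _) Aθ≡Hθ (wA , w𝐋) =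
    subst WellModed (sym (map-++ _ 𝐁 𝐋))
      (WellModedFrom-++ 𝐁θ
        (WellModedFrom-mono 𝐁θ (ground-In ∘ instantiate-In)
          (WellModedFrom-subst θ 𝐁 (WellModedFrom-subst (fun σ) 𝐁₀ (WellModedFrom⁺ 𝐁₀ (proj₁ wC)))))
        (WellModedFrom-mono (substBody θ 𝐋) Out-A (WellModedFrom-subst θ 𝐋 w𝐋)))
    where
    wC : WellModedClause m (H₀ ← 𝐁₀)
    wC = All.lookup wP C∈P
    H  = substAtom (fun σ) H₀
    𝐁  = substBody (fun σ) 𝐁₀
    𝐁θ = substBody θ 𝐁

    ground-In : ∀ {x} → ¬ In m (substAtom θ H) x
    ground-In x∈ with VarAt-subst⁻ A (subst (λ B → In m B _) (sym Aθ≡Hθ) x∈)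
    ... | _ , y∈ , _ = wA y∈

    instantiate-In : Image θ (Image (fun σ) (In m H₀)) ⊆ In m (substAtom θ H)
    instantiate-In (y , (z , z∈ , y∈) , x∈) = VarAt-subst⁺ H (VarAt-subst⁺ H₀ z∈ y∈) x∈

    -- Outputs of `Aθ` are outputs of `Hθ`. By the head condition of well-modedness their variables
    -- stem from inputs of `H`, which became ground, or from outputs of the body.
    Out-A : Image θ (∅ ∪ Out m A) ⊆ ∅ ∪ OutBody m 𝐁θ
    Out-A (y , inj₂ y∈ , x∈) =
      let y′ , y′∈ , x∈′  = VarAt-subst⁻ H (subst (λ B → Out m B _) Aθ≡Hθ (VarAt-subst⁺ A y∈ x∈))
          z , z∈ , y′∈σz = VarAt-subst⁻ H₀ y′∈
      in [ (λ z∈In → ⊥-elim (ground-In (instantiate-In (y′ , (z , z∈In , y′∈σz) , x∈′))))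
         , (λ z∈Out → inj₂ (OutBody-subst⁺ 𝐁 (y′ , OutBody-subst⁺ 𝐁₀ (z , z∈Out , y′∈σz) , x∈′)))
         ]′ (proj₂ wC z∈)

-- Unification of equations that have a solution in the model.

module Unification (S : Signature) {c ℓ r} (M : LogicPrograms.Interpretation S c ℓ r)
  (freeEquality : LogicPrograms.FreeEquality S M) where

  open LogicPrograms S
  open Interpretation M hiding (cong)
  open Setoid domain using ()
    renaming (refl to ≈-refl; sym to ≈-sym; trans to ≈-trans; reflexive to ≈-reflexive)
  open FreeEquality freeEquality
  open Terms S
  open Semantics S M

  Equations : Set
  Equations = List (Term ℕ × Term ℕ)

  Solves : (ℕ → D) → Equations → Set ℓ
  Solves ρ = All λ (s , t) → eval ρ s ≈ eval ρ t

  Unifies : (ℕ → Term ℕ) → Equations → Set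
  Unifies σ = All λ (s , t) → substTerm σ s ≡ substTerm σ t

  -- The length of `V` is the first component of the termination measure; eliminating a variable
  -- shortens it.
  Over : List ℕ → Equations → Set
  Over V = All λ (s , t) → (∀ {x} → x ∈Var s → x ∈ V) × (∀ {x} → x ∈Var t → x ∈ V)

  MostGeneral : Substitution → Equations → Set
  MostGeneral θ E =
    Unifies (fun θ) E ×
    (∀ σ → Unifies (fun σ) E → ∃[ γ ] ∀ x → fun σ x ≡ substTerm (fun γ) (fun θ x))

  substEquations : (ℕ → Term ℕ) → Equations → Equations
  substEquations σ = map λ (s , t) → substTerm σ s , substTerm σ t

  decompose : ∀ {n} → Vec (Term ℕ) n → Vec (Term ℕ) n → Equations → Equations
  decompose []       []       E = E
  decompose (s ∷ ss) (t ∷ ts) E = (s , t) ∷ decompose ss ts E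

  mutual
    size : Term ℕ → ℕ
    size (var x)   = 1
    size (fn f ts) = suc (sizes ts)

    sizes : ∀ {n} → Vec (Term ℕ) n → ℕ
    sizes []       = 0
    sizes (t ∷ ts) = size t + sizes ts

  -- Second component of the measure. Counting the left-hand sides suffices: deleting a trivial
  -- equation and decomposing both shrink them, and every other case eliminates a variable.
  leftSize : Equations → ℕ
  leftSize []            = 0
  leftSize ((s , _) ∷ E) = size s + leftSize E

  leftSize-decompose : ∀ {n} (ss ts : Vec (Term ℕ) n) E →
                       leftSize (decompose ss ts E) ≡ sizes ss + leftSize E
  leftSize-decompose []       []       E = refl
  leftSize-decompose (s ∷ ss) (t ∷ ts) E =
    trans (cong (size s +_) (leftSize-decompose ss ts E)) (sym (+-assoc (size s) (sizes ss) _))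

  Solves-decompose : ∀ {ρ n} {ss ts : Vec (Term ℕ) n} {E} →
                     Pointwise _≈_ (evals ρ ss) (evals ρ ts) → Solves ρ E → Solves ρ (decompose ss ts E)
  Solves-decompose {ss = []}    {[]}    []         es = es
  Solves-decompose {ss = _ ∷ _} {_ ∷ _} (eq ∷ eqs) es = eq ∷ Solves-decompose eqs es

  Unifies-decompose⁺ : ∀ {σ n} (ss ts : Vec (Term ℕ) n) {E} →
                       substTerms σ ss ≡ substTerms σ ts → Unifies σ E → Unifies σ (decompose ss ts E)
  Unifies-decompose⁺ []       []       _  us = us
  Unifies-decompose⁺ (_ ∷ ss) (_ ∷ ts) eq us =
    let eq₁ , eq₂ = ∷-injective eq in eq₁ ∷ Unifies-decompose⁺ ss ts eq₂ us

  Unifies-decompose⁻ : ∀ {σ n} (ss ts : Vec (Term ℕ) n) {E} →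
                       Unifies σ (decompose ss ts E) → substTerms σ ss ≡ substTerms σ ts × Unifies σ E
  Unifies-decompose⁻ []       []       us       = refl , us
  Unifies-decompose⁻ (_ ∷ ss) (_ ∷ ts) (u ∷ us) =
    Product.map₁ (cong₂ _∷_ u) (Unifies-decompose⁻ ss ts us)

  Over-decompose : ∀ {V n} {ss ts : Vec (Term ℕ) n} {E} →
                   (∀ {x} → VecAny.Any (x ∈Var_) ss → x ∈ V) → (∀ {x} → VecAny.Any (x ∈Var_) ts → x ∈ V) →
                   Over V E → Over V (decompose ss ts E)
  Over-decompose {ss = []}    {[]}    _ _ vs = vs
  Over-decompose {ss = _ ∷ _} {_ ∷ _} p q vs =
    (p ∘ VecAny.here , q ∘ VecAny.here) ∷ Over-decompose (p ∘ VecAny.there) (q ∘ VecAny.there) vs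

  fn-injective : ∀ {V : Set} {f} {ss ts : Vec (Term V) (Signature.funArity S f)} →
                 Term.fn f ss ≡ fn f ts → ss ≡ ts
  fn-injective refl = refl

  args-injective : ∀ {V : Set} {p} {ss ts : Vec (Term V) (Signature.relArity S p)} →
                   p $ ss ≡ p $ ts → ss ≡ ts
  args-injective refl = refl

  module Elimination (x : ℕ) (t : Term ℕ) where

    binding : ℕ → Term ℕ
    binding y with y ≟ x
    ... | yes _ = t
    ... | no  _ = var y

    binding-≡ : binding x ≡ t
    binding-≡ with x ≟ x
    ... | yes _   = refl
    ... | no  x≢x = contradiction refl x≢x

    binding-≢ : ∀ {y} → y ≢ x → binding y ≡ var y
    binding-≢ {y} y≢x with y ≟ x
    ... | yes y≡x = contradiction y≡x y≢x
    ... | no  _   = refl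

    binding-∉ : ¬ x ∈Var t → substTerm binding t ≡ t
    binding-∉ x∉t = trans (substTerm-local t λ { y∈ → binding-≢ λ { refl → x∉t y∈ } }) (substTerm-var t)

    compose : Substitution → Substitution
    compose θ = record
      { fun           = fun θ ⊙ binding
      ; finiteSupport = let n , fixed = finiteSupport θ in
          suc x ⊔ n , λ y ≤y → trans
            (cong (substTerm (fun θ)) (binding-≢ (>⇒≢ (≤-trans (m≤m⊔n (suc x) n) ≤y))))
            (fixed y (≤-trans (m≤n⊔m (suc x) n) ≤y))
      }

    -- A unifier of `x` and `t` already identifies what `binding` identifies, so elimination loses
    -- no unifier.
    absorb : ∀ {σ : ℕ → Term ℕ} → σ x ≡ substTerm σ t → ∀ y → σ y ≡ substTerm σ (binding y)
    absorb eq y with y ≟ x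
    ... | yes refl = eq
    ... | no  _    = refl

    absorb-≈ : ∀ {ρ : ℕ → D} → ρ x ≈ eval ρ t → ∀ y → ρ y ≈ eval ρ (binding y)
    absorb-≈ eq y with y ≟ x
    ... | yes refl = eq
    ... | no  _    = ≈-refl

    binding-vars : ¬ x ∈Var t → ∀ {y z} → y ∈Var binding z → (y ≡ z ⊎ y ∈Var t) × y ≢ x
    binding-vars x∉t {y} {z} y∈ with z ≟ x
    ... | yes _   = inj₂ y∈ , λ { refl → x∉t y∈ }
    binding-vars x∉t here | no z≢x = inj₁ refl , z≢x

    -- A unifier `σ` of all equations equals `σ ⊙ binding`, hence unifies the substituted equations
    -- and factors through `θ`; so it factors through `θ ⊙ binding`.
    MostGeneral-compose : ∀ {θ E} → ¬ x ∈Var t → MostGeneral θ (substEquations binding E) →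
                          MostGeneral (compose θ) ((var x , t) ∷ E)
    MostGeneral-compose {θ} {E} x∉t (unifies , universal) =
      (cong (substTerm (fun θ)) (trans binding-≡ (sym (binding-∉ x∉t)))
        ■ substTerm-⊙ (fun θ) binding t) ∷
      All.map (λ { {s , u} eq → sym (substTerm-⊙ (fun θ) binding s) ■ eq ■ substTerm-⊙ (fun θ) binding u })
              (All.map⁻ unifies) ,
      λ { σ (eq ∷ eqs) →
          let absorbed = absorb {fun σ} eq
              σ-binding = λ u → trans (substTerm-⊙ (fun σ) binding u) (sym (substTerm-local u λ {y} _ → absorbed y))
              γ , factors = universal σ (All.map⁺ (All.map
                (λ { {s , u} eq′ → σ-binding s ■ eq′ ■ sym (σ-binding u) }) eqs))
          in γ , λ y → absorbed y ■ substTerm-local (binding y) (λ {z} _ → factors z)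
                       ■ sym (substTerm-⊙ (fun γ) (fun θ) (binding y)) }
      where
      infixr 4 _■_
      _■_ : ∀ {a} {A : Set a} {x y z : A} → x ≡ y → y ≡ z → x ≡ z
      _■_ = trans

    Solves-binding : ∀ {ρ E} → ρ x ≈ eval ρ t → Solves ρ E → Solves ρ (substEquations binding E)
    Solves-binding {ρ} ρx≈ = All.gmap⁺ λ { {s , u} eq →
      ≈-trans (≈-sym (step s)) (≈-trans eq (step u)) }
      where
      step : ∀ u → eval ρ u ≈ eval ρ (substTerm binding u)
      step u = ≈-trans (eval-local u λ {y} _ → absorb-≈ ρx≈ y) (≈-sym (≈-reflexive (eval-subst u)))

    removed : List ℕ → List ℕ
    removed = filter (λ y → ¬? (y ≟ x))

    length-removed : ∀ {V} → x ∈ V → length (removed V) < length V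
    length-removed {V} x∈V = filter-notAll _ V (Any.map (λ x≡y y≢x → y≢x (sym x≡y)) x∈V)

    Over-removed : ∀ {V E} → ¬ x ∈Var t → (∀ {y} → y ∈Var t → y ∈ V) → Over V E →
                   Over (removed V) (substEquations binding E)
    Over-removed {V} x∉t tV = All.gmap⁺ λ { {s , u} (sV , uV) → over s sV , over u uV }
      where
      over : ∀ u → (∀ {y} → y ∈Var u → y ∈ V) → ∀ {y} → y ∈Var substTerm binding u → y ∈ removed V
      over u uV y∈ with ∈Var-subst⁻ u y∈
      ... | z , z∈u , y∈z with binding-vars x∉t y∈z
      ... | inj₁ refl , y≢x = ∈-filter⁺ _ (uV z∈u) y≢x
      ... | inj₂ y∈t  , y≢x = ∈-filter⁺ _ (tV y∈t) y≢x

  open Elimination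

  MostGeneral-cong : ∀ {θ E E′} → (∀ σ → Unifies σ E → Unifies σ E′) →
                     (∀ σ → Unifies σ E′ → Unifies σ E) → MostGeneral θ E → MostGeneral θ E′
  MostGeneral-cong {θ} to from (unifies , universal) = to _ unifies , λ σ → universal σ ∘ from _

  identity : Substitution
  identity = record { fun = var ; finiteSupport = 0 , λ _ _ → refl }

  -- The last component says that `ρ` agrees with `ρ ★ fun θ`, so what is true under `ρ` stays true
  -- under `ρ` after instantiation by `θ`.
  SolvedMGU : (ℕ → D) → Equations → Set ℓ
  SolvedMGU ρ E = ∃[ θ ] MostGeneral θ E × (∀ x → ρ x ≈ eval ρ (fun θ x))

  -- Function symbols need not have decidable equality, hence the double negation.
  mutual
    unify : ∀ {ρ} v s V E → length V ≤ v → leftSize E ≤ s → Over V E → Solves ρ E → ¬ ¬ SolvedMGU ρ E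
    unify v s V [] _ _ _ _ k =
      k (identity , ([] , λ σ _ → σ , λ _ → refl) , λ _ → ≈-refl)
    unify v zero V ((var x , _) ∷ E) _ () _ _ _
    unify v zero V ((fn _ _ , _) ∷ E) _ () _ _ _
    unify v (suc s) V ((var x , var y) ∷ E) V≤v (s≤s E≤s) ((xV , yV) ∷ over) (eq ∷ eqs) k with x ≟ y
    ... | yes refl = unify v s V E V≤v E≤s over eqs λ (θ , mgu , sol) →
      k (θ , MostGeneral-cong {θ} (λ _ → refl ∷_) (λ _ → All.tail) mgu , sol)
    ... | no x≢y = eliminate v V x (var y) E V≤v (xV here) yV (λ { here → x≢y refl }) over eq eqs k
    unify {ρ} v (suc s) V ((var x , t@(fn _ _)) ∷ E) V≤v _ ((xV , tV) ∷ over) (eq ∷ eqs) k =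
      -- The occurs check succeeds because `ρ` solves the equation, which `acyclic` forbids if `x`
      -- occurs in `t`.
      eliminate v V x t E V≤v (xV here) tV (λ x∈t → acyclic x∈t (λ ()) ρ (≈-sym eq)) over eq eqs k
    unify {ρ} v (suc s) V ((t@(fn _ _) , var x) ∷ E) V≤v _ ((tV , xV) ∷ over) (eq ∷ eqs) k =
      eliminate v V x t E V≤v (xV here) tV (λ x∈t → acyclic x∈t (λ ()) ρ eq) over (≈-sym eq) eqs
        λ (θ , mgu , sol) → k (θ , MostGeneral-cong {θ} (λ _ → flip) (λ _ → flip) mgu , sol)
      where
      flip : ∀ {σ s t E} → Unifies σ ((s , t) ∷ E) → Unifies σ ((t , s) ∷ E)
      flip (u ∷ us) = sym u ∷ us
    unify {ρ} v (suc s) V ((fn f ss , fn g ts) ∷ E) V≤v (s≤s E≤s) ((sV , tV) ∷ over) (eq ∷ eqs) k =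
      -- The goal is `⊥`, so `f ≡ g` may be assumed as soon as its negation is refuted; a clash has
      -- no solution by `distinct`.
      (λ f≢g → distinct f≢g _ _ eq) λ { refl →
        unify v s V (decompose ss ts E) V≤v
          (≤-trans (≤-reflexive (leftSize-decompose ss ts E)) E≤s)
          (Over-decompose (sV ∘ there) (tV ∘ there) over)
          (Solves-decompose {ss = ss} {ts} (injective f eq) eqs)
          λ (θ , mgu , sol) →
            k (θ , MostGeneral-cong {θ}
                     (λ _ us → let u , us′ = Unifies-decompose⁻ ss ts us in cong (fn f) u ∷ us′)
                     (λ { _ (u ∷ us) → Unifies-decompose⁺ ss ts (fn-injective u) us })
                     mgu , sol) }

    eliminate : ∀ {ρ} v V x t E → length V ≤ v → x ∈ V → (∀ {y} → y ∈Var t → y ∈ V) →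
                ¬ x ∈Var t → Over V E → ρ x ≈ eval ρ t → Solves ρ E → ¬ ¬ SolvedMGU ρ ((var x , t) ∷ E)
    eliminate zero    (_ ∷ _) x t E () _ _ _ _ _ _ _
    eliminate zero    [] x t E _ () _ _ _ _ _ _
    eliminate {ρ} (suc v) V x t E V≤v x∈V tV x∉t over eq eqs k =
      -- Substitution may enlarge the left-hand sides, but the smaller `v` allows any second bound.
      unify v _ (removed x t V) (substEquations (binding x t) E)
        (≤-pred (≤-trans (length-removed x t x∈V) V≤v)) ≤-refl
        (Over-removed x t x∉t tV over) (Solves-binding x t eq eqs)
        λ (θ , mgu , sol) →
          k (compose x t θ , MostGeneral-compose x t {θ} x∉t mgu ,
             λ y → ≈-trans (absorb-≈ x t eq y)
               (≈-trans (eval-local (binding x t y) λ {z} _ → sol z)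
                        (≈-sym (≈-reflexive (eval-subst (binding x t y))))))

-- Renaming a clause apart from a query.

module Renaming (S : Signature) where

  open LogicPrograms S
  open Terms S

  mutual
    boundTerm : (t : Term ℕ) → ∃[ n ] ∀ {x} → x ∈Var t → x < n
    boundTerm (var x)   = suc x , λ { here → ≤-refl }
    boundTerm (fn f ts) = let n , <n = boundTerms ts in n , λ { (there x∈) → <n x∈ }

    boundTerms : ∀ {k} (ts : Vec (Term ℕ) k) → ∃[ n ] ∀ {x} → VecAny.Any (x ∈Var_) ts → x < n
    boundTerms []       = 0 , λ ()
    boundTerms (t ∷ ts) =
      let n , <n = boundTerm t ; n′ , <n′ = boundTerms ts in
      n ⊔ n′ , λ { (VecAny.here x∈)  → ≤-trans (<n x∈) (m≤m⊔n n n′)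
                 ; (VecAny.there x∈) → ≤-trans (<n′ x∈) (m≤n⊔m n n′) }

  boundBody : (Q : Query) → ∃[ n ] ∀ {x} → VarBody Q x → x < n
  boundBody []      = 0 , λ ()
  boundBody (L ∷ Q) =
    let n , <n = boundTerms (args (atomOf L)) ; n′ , <n′ = boundBody Q in
    n ⊔ n′ , λ { (here x∈)  → ≤-trans (<n x∈) (m≤m⊔n n n′)
               ; (there x∈) → ≤-trans (<n′ x∈) (m≤n⊔m n n′) }

  boundClause : (C : Clause ℕ) → ∃[ n ] ∀ {x} → VarClause C x → x < n
  boundClause (H ← Q) =
    let n , <n = boundTerms (args H) ; n′ , <n′ = boundBody Q in
    n ⊔ n′ , λ { (inj₁ x∈) → ≤-trans (<n x∈) (m≤m⊔n n n′)
               ; (inj₂ x∈) → ≤-trans (<n′ x∈) (m≤n⊔m n n′) }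

  -- A shift of all variables would not have finite support, so the blocks
  -- [0, n) and [n, 2n) are exchanged.
  module Swap (n : ℕ) where

    swap : ℕ → ℕ
    swap x with x <? n | x <? n + n
    ... | yes _ | _     = x + n
    ... | no  _ | yes _ = x ∸ n
    ... | no  _ | no  _ = x

    swap-low : ∀ {x} → x < n → swap x ≡ x + n
    swap-low {x} x<n with x <? n | x <? n + n
    ... | yes _   | _ = refl
    ... | no  x≮n | _ = contradiction x<n x≮n

    swap-middle : ∀ {x} → x < n → swap (x + n) ≡ x
    swap-middle {x} x<n with x + n <? n | x + n <? n + n
    ... | yes lt | _      = contradiction lt (≤⇒≯ (m≤n+m n x))
    ... | no  _  | yes _  = m+n∸n≡m x n
    ... | no  _  | no  ≮  = contradiction (+-monoˡ-< n x<n) ≮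

    swap-high : ∀ {x} → n + n ≤ x → swap x ≡ x
    swap-high {x} ≤x with x <? n | x <? n + n
    ... | yes x<n | _       = contradiction x<n (≤⇒≯ (≤-trans (m≤m+n n n) ≤x))
    ... | no  _   | yes lt  = contradiction lt (≤⇒≯ ≤x)
    ... | no  _   | no  _   = refl

    swap-involutive : ∀ x → swap (swap x) ≡ x
    swap-involutive x = by-cases (x <? n) (x <? n + n)
      where
      by-cases : Dec (x < n) → Dec (x < n + n) → swap (swap x) ≡ x
      by-cases (yes x<n) _ = trans (cong swap (swap-low x<n)) (swap-middle x<n)
      by-cases (no x≮n) (yes x<2n) = subst (λ y → swap (swap y) ≡ y) (m∸n+n≡m (≮⇒≥ x≮n))
        (trans (cong swap (swap-middle x∸n<n)) (swap-low x∸n<n))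
        where
        x∸n<n : x ∸ n < n
        x∸n<n = +-cancelʳ-< n (x ∸ n) n (subst (_< n + n) (sym (m∸n+n≡m (≮⇒≥ x≮n))) x<2n)
      by-cases (no _) (no x≮2n) = trans (cong swap (swap-high (≮⇒≥ x≮2n))) (swap-high (≮⇒≥ x≮2n))

    -- A single assignment for a query and a renamed clause: `ρ` on the query variables below `n`,
    -- and `ρ₀`, transported along `swap`, on the clause variables.
    merge : ∀ {a} {A : Set a} → (ℕ → A) → (ℕ → A) → ℕ → A
    merge ρ ρ₀ x with x <? n
    ... | yes _ = ρ x
    ... | no  _ = ρ₀ (swap x)

    module _ {a} {A : Set a} {ρ ρ₀ : ℕ → A} where

      merge-low : ∀ {x} → x < n → merge ρ ρ₀ x ≡ ρ x
      merge-low {x} x<n with x <? n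
      ... | yes _   = refl
      ... | no  x≮n = contradiction x<n x≮n

      merge-swap : ∀ {x} → x < n → merge ρ ρ₀ (swap x) ≡ ρ₀ x
      merge-swap {x} x<n with swap x <? n
      ... | yes lt = contradiction (subst (_< n) (swap-low x<n) lt) (≤⇒≯ (m≤n+m n x))
      ... | no  _  = cong ρ₀ (swap-involutive x)

    swapping : Substitution
    swapping = record { fun = var ∘ swap ; finiteSupport = n + n , λ _ → cong var ∘ swap-high }

    -- The exchange is its own inverse, so one substitution serves both directions of `Variant`.
    swap-variant : ∀ C → Variant (substClause (fun swapping) C) C
    swap-variant C = (swapping , refl) , (swapping , sym (trans (substClause-⊙ _ _ C) (identity C)))
      where
      identity : ∀ C → substClause (var ∘ swap ∘ swap) C ≡ C
      identity ((p $ ts) ← Q) = cong₂ (λ us → (p $ us) ←_)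
        (trans (substTerms-local ts λ {x} _ → cong var (swap-involutive x)) (substTerms-var ts))
        (trans (map-cong (λ L → identityL L) Q) (map-id Q))
        where
        identityL : ∀ L → substLiteral (var ∘ swap ∘ swap) L ≡ L
        identityL (pos (q $ us)) = cong (pos ∘ (q $_))
          (trans (substTerms-local us λ {x} _ → cong var (swap-involutive x)) (substTerms-var us))
        identityL (neg (q $ us)) = cong (neg ∘ (q $_))
          (trans (substTerms-local us λ {x} _ → cong var (swap-involutive x)) (substTerms-var us))

    swap-apart : ∀ C Q → (∀ {x} → VarClause C x → x < n) → (∀ {x} → VarBody Q x → x < n) →
                 RenamedApart (substClause (fun swapping) C) Q
    swap-apart (H ← 𝐁) Q C<n Q<n y y∈C y∈Q = ≤⇒≯ (n≤y y∈C) (Q<n y∈Q)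
      where
      image : ∀ {x} → VarClause (H ← 𝐁) x → y ∈Var var (swap x) → n ≤ y
      image x∈ here = ≤-trans (m≤n+m n _) (≤-reflexive (sym (swap-low (C<n x∈))))

      n≤y : VarClause (substClause (fun swapping) (H ← 𝐁)) y → n ≤ y
      n≤y (inj₁ y∈) = let _ , x∈ , y∈x = ∈Vars-subst⁻ (args H) y∈ in image (inj₁ x∈) y∈x
      n≤y (inj₂ y∈) = let _ , x∈ , y∈x = VarBody-subst⁻ 𝐁 y∈ in image (inj₂ x∈) y∈x

-- Soundness of success and finite failure in a complete model.

module Soundness (S : Signature) {c ℓ r} (M : LogicPrograms.Interpretation S c ℓ r)
  (G : LogicPrograms.Program S) (complete : LogicPrograms.CompleteModel S M G) where

  open LogicPrograms S
  open Interpretation M hiding (cong)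
  open Setoid domain using () renaming (sym to ≈-sym; trans to ≈-trans; reflexive to ≈-reflexive)
  open CompleteModel complete
  open Terms S
  open Semantics S M
  open Unification S M freeEquality
  open Renaming S

  Completed : Pred (Literal ℕ) 0ℓ
  Completed L = Neg* G (rel (atomOf L))

  -- Soundness of success appeals to the completion for negative literals only, since `model` covers
  -- positive ones. All clause bodies of `G` have this property.
  NegCompleted : Pred (Literal ℕ) 0ℓ
  NegCompleted (pos A) = ⊤
  NegCompleted (neg A) = Neg* G (rel A)

  NegCompleted-subst : ∀ {σ : ℕ → Term ℕ} {Q} → All NegCompleted Q → All NegCompleted (substBody σ Q)
  NegCompleted-subst = All.gmap⁺ λ { {pos _} n → n ; {neg _} n → n }

  NegCompleted-clause : ∀ {C} → C ∈ G → All NegCompleted (body C)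
  NegCompleted-clause {C} C∈G = All.tabulate λ
    { {pos _}        _  → tt
    ; {neg (p $ ts)} L∈ → p , (C , C∈G , ts , L∈) , ε }

  Completed-clause : ∀ {C} → C ∈ G → Neg* G (rel (head C)) → All Completed (body C)
  Completed-clause C∈G (p , neg-p , p⇒H) = All.tabulate λ L∈ →
    p , neg-p , p⇒H ◅◅ (lose C∈G (refl , lose L∈ refl) ◅ ε)

  NegCompleted-variant : ∀ {C H 𝐁} → C ∈ G → Variant (H ← 𝐁) C → All NegCompleted 𝐁
  NegCompleted-variant C∈G ((σ , refl) , _) = NegCompleted-subst {fun σ} (NegCompleted-clause C∈G)

  NegCompleted-resolvent : ∀ {A 𝐋 C H 𝐁} {θ : ℕ → Term ℕ} → C ∈ G → Variant (H ← 𝐁) C →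
                           All NegCompleted (pos A ∷ 𝐋) → All NegCompleted (substBody θ (𝐁 ++ 𝐋))
  NegCompleted-resolvent C∈G v (_ ∷ ns) = NegCompleted-subst (All.++⁺ (NegCompleted-variant C∈G v) ns)

  clause-sound : ∀ {A C H 𝐁} {θ : ℕ → Term ℕ} {ρ} → C ∈ G → Variant (H ← 𝐁) C →
                 substAtom θ A ≡ substAtom θ H → ⊨Body ρ (substBody θ 𝐁) → ⊨Atom ρ (substAtom θ A)
  clause-sound {A} {H₀ ← 𝐁₀} {H} {𝐁} {θ} {ρ} C∈G ((σ , refl) , _) Aθ≡Hθ ⊨𝐁 =
    subst (⊨Atom ρ) (sym Aθ≡Hθ) (⊨Literal-subst⁺ (pos H)
      (⊨Literal-subst⁺ (pos H₀) (model C∈G _ (⊨Body-subst⁻ 𝐁₀ (⊨Body-subst⁻ 𝐁 ⊨𝐁)))))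

  resolution-sound : ∀ {A 𝐋 C H 𝐁} {θ : ℕ → Term ℕ} {ρ} → C ∈ G → Variant (H ← 𝐁) C →
                     substAtom θ A ≡ substAtom θ H →
                     ⊨Body ρ (substBody θ (𝐁 ++ 𝐋)) → ⊨Body (ρ ★ θ) (pos A ∷ 𝐋)
  resolution-sound {A} {𝐋} {C} {H} {𝐁} {θ} {ρ} C∈G v Aθ≡Hθ ⊨𝐁𝐋 =
    ⊨Literal-subst⁻ (pos A) (clause-sound {A} C∈G v Aθ≡Hθ (⊨Body-subst⁺ 𝐁 (All.++⁻ˡ 𝐁 ⊨𝐁𝐋θ))) ∷
    All.++⁻ʳ 𝐁 ⊨𝐁𝐋θ
    where
    ⊨𝐁𝐋θ : ⊨Body (ρ ★ θ) (𝐁 ++ 𝐋)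
    ⊨𝐁𝐋θ = ⊨Body-subst⁻ (𝐁 ++ 𝐋) ⊨𝐁𝐋

  -- A semantic lifting lemma. Once the clause is renamed, `ρ` and `ρ₀` merge into one assignment
  -- that solves the equations between the arguments; `unify` then yields an mgu that keeps the
  -- resolvent true.
  clause-resolvent : ∀ {p ts 𝐋 us 𝐁 ρ ρ₀} → Pointwise _≈_ (evals ρ ts) (evals ρ₀ us) →
    ⊨Body ρ 𝐋 → ⊨Body ρ₀ 𝐁 →
    ¬ ¬ (∃[ σ ] ∃[ θ ] Variant (substClause (fun σ) (p $ us ← 𝐁)) (p $ us ← 𝐁) ×
         RenamedApart (substClause (fun σ) (p $ us ← 𝐁)) (pos (p $ ts) ∷ 𝐋) ×
         MGU θ (p $ ts) (p $ substTerms (fun σ) us) ×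
         (∃[ ρ₁ ] ⊨Body ρ₁ (substBody (fun θ) (substBody (fun σ) 𝐁 ++ 𝐋))))
  clause-resolvent {p} {ts} {𝐋} {us} {𝐁} {ρ} {ρ₀} ts≈us ⊨𝐋 ⊨𝐁 k =
    unify _ _ (upTo (proj₁ E-bound)) E ≤-refl ≤-refl E-over solves λ (θ , mgu , sol) →
      k (swapping , θ , swap-variant C , swap-apart C (pos (p $ ts) ∷ 𝐋) C<N Q<N , MGU-atoms {θ} mgu ,
         ρ₁ , ⊨Body-subst⁺ (substBody (fun swapping) 𝐁 ++ 𝐋)
                (⊨Body-local (substBody (fun swapping) 𝐁 ++ 𝐋) (λ {x} _ → sol x) ⊨₁))
    where
    C   = p $ us ← 𝐁
    N   = proj₁ (boundClause C) ⊔ proj₁ (boundBody (pos (p $ ts) ∷ 𝐋))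
    C<N : ∀ {x} → VarClause C x → x < N
    C<N x∈ = ≤-trans (proj₂ (boundClause C) x∈) (m≤m⊔n (proj₁ (boundClause C)) _)
    Q<N : ∀ {x} → VarBody (pos (p $ ts) ∷ 𝐋) x → x < N
    Q<N x∈ = ≤-trans (proj₂ (boundBody (pos (p $ ts) ∷ 𝐋)) x∈) (m≤n⊔m (proj₁ (boundClause C)) _)
    open Swap N

    vs = substTerms (fun swapping) us
    E  = decompose ts vs []

    ρ₁ : ℕ → D
    ρ₁ = merge ρ ρ₀

    ρ₁-query : ∀ {x} → x < N → ρ x ≈ ρ₁ x
    ρ₁-query = ≈-reflexive ∘ sym ∘ merge-low

    ρ₁-clause : ∀ {x} → x < N → ρ₀ x ≈ ρ₁ (swap x)
    ρ₁-clause = ≈-reflexive ∘ sym ∘ merge-swap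

    ⊨₁ : ⊨Body ρ₁ (substBody (fun swapping) 𝐁 ++ 𝐋)
    ⊨₁ = All.++⁺ (⊨Body-subst⁺ 𝐁 (⊨Body-local 𝐁 (ρ₁-clause ∘ C<N ∘ inj₂) ⊨𝐁))
                 (⊨Body-local 𝐋 (ρ₁-query ∘ Q<N ∘ there) ⊨𝐋)

    solves : Solves ρ₁ E
    solves = Solves-decompose {ss = ts} {vs}
      (Pointwise.trans ≈-trans (Pointwise.sym ≈-sym (evals-local ts (ρ₁-query ∘ Q<N ∘ here)))
        (Pointwise.trans ≈-trans ts≈us
          (subst (Pointwise _≈_ _) (sym (evals-subst us)) (evals-local us (ρ₁-clause ∘ C<N ∘ inj₁)))))
      []

    E-bound : ∃[ n ] ∀ {x} → VarBody (pos (p $ ts) ∷ pos (p $ vs) ∷ []) x → x < n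
    E-bound = boundBody (pos (p $ ts) ∷ pos (p $ vs) ∷ [])

    E-over : Over (upTo (proj₁ E-bound)) E
    E-over = Over-decompose {ss = ts} {vs}
      (λ x∈ → ∈-upTo⁺ (proj₂ E-bound (here x∈))) (λ x∈ → ∈-upTo⁺ (proj₂ E-bound (there (here x∈)))) []

    MGU-atoms : ∀ {θ} → MostGeneral θ E → MGU θ (p $ ts) (p $ vs)
    MGU-atoms (unifies , universal) =
      cong (p $_) (proj₁ (Unifies-decompose⁻ ts vs unifies)) ,
      λ σ Aσ≡Hσ → universal σ (Unifies-decompose⁺ ts vs (args-injective Aσ≡Hσ) [])

  mutual
    -- If the selected atom were true, the completion would supply a clause with a true body, and
    -- `clause-resolvent` a true child of a node whose children are all finitely failed.
    finitelyFailed-sound : ∀ {Q} (T : Tree G Q) → All Completed Q → FinitelyFailed T →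
                           ∀ ρ → ¬ ⊨Body ρ Q
    finitelyFailed-sound (positive {p $ ts} {𝐋} children) (n ∷ ns) ff ρ (⊨A ∷ ⊨𝐋) =
      let us , 𝐁 , (C∈G , n′) , ρ₀ , ts≈us , ⊨𝐁 = Equivalence.to (completion n (evals ρ ts)) ⊨A in
      clause-resolvent {us = us} ts≈us ⊨𝐋 ⊨𝐁 λ (σ , θ , v , apart , mgu , ρ₁ , ⊨Q′) →
        finitelyFailed-sound (children (resolve {θ = θ} C∈G v apart mgu))
          (All-rel-subst {X = Neg* G} _ (All.++⁺ (All-rel-subst {X = Neg* G} _ (Completed-clause C∈G n′)) ns))
          (ff (resolve {θ = θ} C∈G v apart mgu)) ρ₁ ⊨Q′
    finitelyFailed-sound (negStep _ _ _ U) (_ ∷ ns) ff ρ (_ ∷ ⊨𝐋) = finitelyFailed-sound U ns ff ρ ⊨𝐋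
    finitelyFailed-sound (negLeaf {A} ground T _) _ succ ρ (⊭A ∷ _) =
      let ρ′ , ⊨[A] = successful-sound T (tt ∷ []) succ ρ in
      -- The subsidiary tree makes `A` true under some assignment `ρ′`; as `A` is ground, it is then
      -- true under `ρ`.
      ⊭A (⊨Atom-local A (λ x∈ → contradiction x∈ (ground _)) (All.head ⊨[A]))

    -- The given assignment is returned at the empty query; on the way back up the branch it is
    -- composed with the mgus.
    successful-sound : ∀ {Q} (T : Tree G Q) → All NegCompleted Q → Successful T →
                       (ℕ → D) → ∃[ ρ ] ⊨Body ρ Q
    successful-sound empty _ _ ρ = ρ , []
    successful-sound (positive children) ns (_ , s@(resolve C∈G v _ mgu) , succ) ρ =
      let ρ′ , ⊨Q′ = successful-sound (children s) (NegCompleted-resolvent C∈G v ns) succ ρ in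
      _ , resolution-sound C∈G v (proj₁ mgu) ⊨Q′
    successful-sound (negStep {A} ground T ff U) (n ∷ ns) succ ρ =
      let ρ′ , ⊨𝐋 = successful-sound U ns succ ρ in
      ρ′ , (λ ⊨A → finitelyFailed-sound T (n ∷ []) ff ρ′ (⊨A ∷ [])) ∷ ⊨𝐋

-- Termination of the extended program.

module Termination (S : Signature) {c ℓ r} (m : LogicPrograms.Moding S) (P R : LogicPrograms.Program S)
  (wellModed : LogicPrograms.WellModedProgram S m (P ++ R)) (extends : LogicPrograms._Extends_ S P R)
  (M : LogicPrograms.Interpretation S c ℓ r) (complete : LogicPrograms.CompleteModel S M (P ++ R))
  where

  open Signature S using (hasConstant)
  open LogicPrograms S
  open Interpretation M hiding (cong)
  open Terms S
  open Semantics S M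
  open Modes S m
  open Soundness S M (P ++ R) complete

  G : Program
  G = P ++ R

  NotInP : Pred (Literal ℕ) 0ℓ
  NotInP L = ¬ Defined P (rel (atomOf L))

  rel-variant : ∀ {A C H 𝐁} {θ : ℕ → Term ℕ} → Variant (H ← 𝐁) C → substAtom θ A ≡ substAtom θ H →
                rel (head C) ≡ rel A
  rel-variant ((σ , refl) , _) Aθ≡Hθ = sym (cong rel Aθ≡Hθ)

  clause-of-P : ∀ {A C H 𝐁} {θ : ℕ → Term ℕ} → Defined P (rel A) →
                C ∈ G → Variant (H ← 𝐁) C → substAtom θ A ≡ substAtom θ H → C ∈ P
  clause-of-P {A} d C∈G v Aθ≡Hθ with ∈-++⁻ P C∈G
  ... | inj₁ C∈P = C∈P
  ... | inj₂ C∈R = contradiction (inj₁ (lose C∈R (rel-variant {A} v Aθ≡Hθ))) (extends _ d)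

  clause-of-R : ∀ {A C H 𝐁} {θ : ℕ → Term ℕ} → NotInP (pos A) →
                C ∈ G → Variant (H ← 𝐁) C → substAtom θ A ≡ substAtom θ H → C ∈ R
  clause-of-R {A} n C∈G v Aθ≡Hθ with ∈-++⁻ P C∈G
  ... | inj₁ C∈P = contradiction (lose C∈P (rel-variant {A} v Aθ≡Hθ)) n
  ... | inj₂ C∈R = C∈R

  NotInP-resolvent : ∀ {C H 𝐁 𝐋} {θ : ℕ → Term ℕ} → C ∈ R → Variant (H ← 𝐁) C →
                     All NotInP 𝐋 → All NotInP (substBody θ (𝐁 ++ 𝐋))
  NotInP-resolvent C∈R ((σ , refl) , _) ns =
    All-rel-subst {X = ¬_ ∘ Defined P} _ (All.++⁺ (All-rel-subst {X = ¬_ ∘ Defined P} (fun σ)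
      (All.tabulate λ L∈ d → extends _ d (inj₂ (lose C∈R (lose L∈ refl))))) ns)

  -- Kept symmetric in the two programs because the transfer of finite failure below needs both
  -- directions at once.
  Simulates : Program → Program → Set
  Simulates F F′ = ∀ {Q Q′} → All NotInP Q → F ⊢ Q ⟶⁺ Q′ → F′ ⊢ Q ⟶⁺ Q′ × All NotInP Q′

  R-simulates : Simulates G R
  R-simulates (n ∷ ns) (resolve {A} {θ = θ} C∈G v apart mgu) =
    let C∈R = clause-of-R {A} {θ = fun θ} n C∈G v (proj₁ mgu) in
    resolve {θ = θ} C∈R v apart mgu , NotInP-resolvent C∈R v ns

  G-simulates : Simulates R G
  G-simulates (n ∷ ns) (resolve {θ = θ} C∈R v apart mgu) =
    resolve {θ = θ} (∈-++⁺ʳ P C∈R) v apart mgu , NotInP-resolvent C∈R v ns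

  mutual
    -- At a ground negative literal the two trees might take different constructors. Transferring
    -- the finite failure of one subsidiary tree to the other, in whichever direction applies,
    -- refutes this.
    finitelyFailed-transfer : ∀ {F F′ Q} → Simulates F F′ → Simulates F′ F → All NotInP Q →
      (T : Tree F Q) (T′ : Tree F′ Q) → FinitelyFailed T → FinitelyFailed T′
    finitelyFailed-transfer to from ns (positive T) (positive T′) ff s′ =
      let s , ns′ = from ns s′ in finitelyFailed-transfer to from ns′ (T s) (T′ s′) (ff s)
    finitelyFailed-transfer to from ns (negStep g _ _ _) (flounder ¬g) _ = contradiction g ¬g
    finitelyFailed-transfer to from (_ ∷ ns) (negStep _ _ _ U) (negStep _ _ _ U′) ff =
      finitelyFailed-transfer to from ns U U′ ff
    finitelyFailed-transfer to from (n ∷ _) (negStep _ T ff _) (negLeaf _ T′ ¬ff′) _ =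
      contradiction (finitelyFailed-transfer to from (n ∷ []) T T′ ff) ¬ff′
    finitelyFailed-transfer to from ns (negLeaf g _ _) (flounder ¬g) _ = contradiction g ¬g
    finitelyFailed-transfer to from (n ∷ _) (negLeaf _ T ¬ff) (negStep _ T′ ff′ _) _ =
      contradiction (finitelyFailed-transfer from to (n ∷ []) T′ T ff′) ¬ff
    finitelyFailed-transfer to from (n ∷ _) (negLeaf _ T _) (negLeaf _ T′ _) succ =
      successful-transfer to from (n ∷ []) T T′ succ

    successful-transfer : ∀ {F F′ Q} → Simulates F F′ → Simulates F′ F → All NotInP Q →
      (T : Tree F Q) (T′ : Tree F′ Q) → Successful T → Successful T′
    successful-transfer to from ns empty empty _ = tt
    successful-transfer to from ns (positive T) (positive T′) (Q , s , succ) =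
      let s′ , ns′ = to ns s in Q , s′ , successful-transfer to from ns′ (T s) (T′ s′) succ
    successful-transfer to from ns (negStep g _ _ _) (flounder ¬g) _ = contradiction g ¬g
    successful-transfer to from (_ ∷ ns) (negStep _ _ _ U) (negStep _ _ _ U′) succ =
      successful-transfer to from ns U U′ succ
    successful-transfer to from (n ∷ _) (negStep _ T ff _) (negLeaf _ T′ ¬ff′) _ =
      contradiction (finitelyFailed-transfer to from (n ∷ []) T T′ ff) ¬ff′

  -- Negative steps carry a tree over their own program, so reading a `G`-derivation as an
  -- `R`-derivation requires restricting these trees as well.
  restrictTree : ∀ {Q} → All NotInP Q → Tree G Q → Tree R Q
  restrictTree ns empty        = empty
  restrictTree ns (positive T) = positive λ s → let s′ , ns′ = G-simulates ns s in restrictTree ns′ (T s′)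
  restrictTree ns (flounder ¬g) = flounder ¬g
  restrictTree (n ∷ ns) (negStep g T ff U) =
    negStep g (restrictTree (n ∷ []) T)
      (finitelyFailed-transfer R-simulates G-simulates (n ∷ []) T (restrictTree (n ∷ []) T) ff) (restrictTree ns U)
  restrictTree (n ∷ ns) (negLeaf g T ¬ff) =
    negLeaf g (restrictTree (n ∷ []) T)
      (¬ff ∘ finitelyFailed-transfer G-simulates R-simulates (n ∷ []) (restrictTree (n ∷ []) T) T)

  -- Derivations from atoms not defined in `P`.

  finite-by-step : ∀ {Q} → (∀ {Q′} → G ⊢ Q ↝ Q′ → AllDerivationsFinite G Q′) → AllDerivationsFinite G Q
  finite-by-step finite (Qs , refl , steps) = finite (steps 0) (Qs ∘ suc , refl , steps ∘ suc)

  finite-[] : AllDerivationsFinite G []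
  finite-[] = finite-by-step λ { (resolvent (positive ())) }

  wellModed-step : ∀ {Q Q′} → G ⊢ Q ↝ Q′ → WellModed Q → WellModed Q′
  wellModed-step (resolvent (positive (resolve {A} {θ = θ} C∈G v _ mgu))) w =
    wellModed-resolvent {A = A} {θ = fun θ} wellModed C∈G v (proj₁ mgu) w
  wellModed-step (resolvent (negative {A} g _ _)) w = wellModed-negative {A} g w
  wellModed-step (subsidiary g)                   w = proj₁ w , tt

  -- Here `θ` is the substitution accumulated so far. Once `𝐁` is empty, the last component makes
  -- `Aθ` true under every assignment.
  Answer : Atom ℕ → Query → Query → Query → Set _
  Answer A 𝐋 𝐁 𝐋′ =
    ∃[ θ ] 𝐋′ ≡ substBody θ 𝐋 × (∀ ρ → ⊨Body ρ 𝐁 → ⊨Atom ρ (substAtom θ A))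

  -- A query in a derivation from A, 𝐋 before A has been resolved away: 𝐁 stems from A
  -- and 𝐋′ from 𝐋, unless a subsidiary tree has been entered, where 𝐋′ is empty.
  record Pending (A : Atom ℕ) (𝐋 Q : Query) : Set (c Level.⊔ r) where
    constructor pending
    field
      {𝐁 𝐋′} : Query
      split   : Q ≡ 𝐁 ++ 𝐋′
      notInP  : All NotInP 𝐁
      negated : All NegCompleted 𝐁
      answer  : Answer A 𝐋 𝐁 𝐋′ ⊎ 𝐋′ ≡ []
  open Pending

  -- The step acts on the first literal of `𝐁`, whose relation is not defined in `P`, so it is also
  -- a step of `R` on `𝐁` alone. The answer is composed with the mgu.
  pending-step : ∀ {A 𝐋 Q Q′} (s : Pending A 𝐋 Q) → 𝐁 s ≢ [] → G ⊢ Q ↝ Q′ →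
                 Σ (Pending A 𝐋 Q′) λ s′ → R ⊢ 𝐁 s ↝ 𝐁 s′
  pending-step (pending {[]} _ _ _ _) 𝐁≢[] _ = contradiction refl 𝐁≢[]
  pending-step {A} {𝐋} (pending {pos B ∷ 𝐁} {𝐋′} refl ns@(n ∷ ns′) cs ans) _
               (resolvent (positive (resolve {H = H} {𝐁 = 𝐂} {θ = θ} C∈G v apart mgu))) =
    pending (trans (cong (substBody (fun θ)) (sym (++-assoc 𝐂 𝐁 𝐋′))) (map-++ _ (𝐂 ++ 𝐁) 𝐋′))
      (NotInP-resolvent C∈R v ns′)
      (NegCompleted-resolvent {A = B} C∈G v cs)
      ([ inj₁ ∘ extend , (λ { refl → inj₂ refl }) ]′ ans) ,
    resolvent (positive (resolve {θ = θ} C∈R v (λ x x∈C x∈Q → apart x x∈C (Any.++⁺ˡ x∈Q)) mgu))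
    where
    C∈R : _ ∈ R
    C∈R = clause-of-R {B} {θ = fun θ} n C∈G v (proj₁ mgu)

    extend : Answer A 𝐋 (pos B ∷ 𝐁) 𝐋′ → Answer A 𝐋 (substBody (fun θ) (𝐂 ++ 𝐁)) (substBody (fun θ) 𝐋′)
    extend (η , refl , sound) =
      fun θ ⊙ η , substBody-⊙ (fun θ) η 𝐋 , λ ρ ⊨𝐂𝐁 →
        subst (⊨Atom ρ) (substAtom-⊙ (fun θ) η A)
          (⊨Literal-subst⁺ (pos (substAtom η A))
            (sound (ρ ★ fun θ) (resolution-sound {B} {𝐁} C∈G v (proj₁ mgu) ⊨𝐂𝐁)))
  pending-step {A} {𝐋} (pending {neg B ∷ 𝐁} {𝐋′} refl (n ∷ ns) (c ∷ cs) ans) _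
               (resolvent (negative g T ff)) =
    pending refl ns cs ([ inj₁ ∘ extend , inj₂ ]′ ans) ,
    resolvent (negative g (restrictTree (n ∷ []) T)
      (finitelyFailed-transfer R-simulates G-simulates (n ∷ []) T (restrictTree (n ∷ []) T) ff))
    where
    extend : Answer A 𝐋 (neg B ∷ 𝐁) 𝐋′ → Answer A 𝐋 𝐁 𝐋′
    extend (η , eq , sound) = η , eq , λ ρ ⊨𝐁 →
      sound ρ ((λ ⊨B → finitelyFailed-sound T (c ∷ []) ff ρ (⊨B ∷ [])) ∷ ⊨𝐁)
  pending-step (pending {neg B ∷ 𝐁} refl (n ∷ ns) cs ans) _ (subsidiary g) =
    -- The subsidiary tree starts from `B` alone, so no part of `𝐋` remains to be continued with.
    pending refl (n ∷ []) (tt ∷ []) (inj₂ refl) , subsidiary g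

  -- The continuation of a call: `θ` is its computed answer. Truth of `Lθ` is promised under
  -- `NegCompleted L` because soundness of negation as failure is available only for relations in
  -- `Neg* G`.
  FiniteAfter : Literal ℕ → Query → Set _
  FiniteAfter L 𝐋 = ∀ (θ : ℕ → Term ℕ) → WellModed (substBody θ 𝐋) →
    (NegCompleted L → ∀ ρ → ⊨Literal ρ (substLiteral θ L)) → AllDerivationsFinite G (substBody θ 𝐋)

  -- If `𝐁` never becomes empty along the derivation, its successive values form an infinite
  -- derivation of `R` from `A`.
  finite-notInP : ∀ {A 𝐋} → NotInP (pos A) → AllDerivationsFinite R [ pos A ] →
                  WellModed (pos A ∷ 𝐋) → FiniteAfter (pos A) 𝐋 → AllDerivationsFinite G (pos A ∷ 𝐋)
  finite-notInP {A} {𝐋} n finite w after (Qs , Qs₀ , steps) =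
    finite (𝐁 ∘ run , refl , λ k → proj₂ (pending-step (run k) (unfinished k (run k)) (steps k)))
    where
    wellModed-run : ∀ k → WellModed (Qs k)
    wellModed-run zero    = subst WellModed (sym Qs₀) w
    wellModed-run (suc k) = wellModed-step (steps k) (wellModed-run k)

    -- If `𝐁` were empty at stage `k`, the rest of the derivation would be an infinite one from an
    -- instance of `𝐋`, against `after`, or from the empty query.
    unfinished : ∀ k (s : Pending A 𝐋 (Qs k)) → 𝐁 s ≢ []
    unfinished k (pending Qₖ≡ _ _ (inj₁ (θ , refl , sound))) refl =
      after θ (subst WellModed Qₖ≡ (wellModed-run k)) (λ _ ρ → sound ρ [])
        ((λ j → Qs (j + k)) , Qₖ≡ , λ j → steps (j + k))
    unfinished k (pending Qₖ≡ _ _ (inj₂ refl)) refl =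
      finite-[] ((λ j → Qs (j + k)) , Qₖ≡ , λ j → steps (j + k))

    run : ∀ k → Pending A 𝐋 (Qs k)
    run zero    = pending {𝐁 = [ pos A ]} Qs₀ (n ∷ []) (tt ∷ [])
      (inj₁ (var , sym (substBody-var 𝐋) ,
             λ { ρ (⊨A ∷ []) → subst (⊨Atom ρ) (sym (substAtom-var A)) ⊨A }))
    run (suc k) = proj₁ (pending-step (run k) (unfinished k (run k)) (steps k))

  -- Induction on levels.

  module _ (∣_∣ : LevelMapping P) (moded : Moded m ∣_∣) (acceptable : Acceptable P ∣_∣ M)
    (finite-R : ∀ Q → WellModedQuery m Q → AllDerivationsFinite R Q) where

    -- Levels exist only on `Base P`; quantifying over `B` makes the bound vacuous for relations
    -- that do not occur in `P`.
    LevelBelow : ℕ → Atom ⊥ → Set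
    LevelBelow n A = (B : Base P) → atom B ≡ A → ∣ B ∣ < n

    -- As in acceptability, each literal is bounded only if the literals before it are true in `M`.
    BoundedGround : ℕ → Body ⊥ → Set r
    BoundedGround n []      = Level.Lift r ⊤
    BoundedGround n (L ∷ Q) = LevelBelow n (atomOf L) × (⊨Ground M [ L ] → BoundedGround n Q)

    Bounded : ℕ → Query → Set r
    Bounded n Q = ∀ (σ : ℕ → Term ⊥) → BoundedGround n (substBody σ Q)

    BoundedLiteral : ℕ → Literal ℕ → Set
    BoundedLiteral n L = ∀ (σ : ℕ → Term ⊥) → LevelBelow n (atomOf (substLiteral σ L))

    constant : ℕ → Term ⊥
    constant _ = let f , arity≡0 = hasConstant in fn f (subst (Vec (Term ⊥)) (sym arity≡0) [])

    bounded-ground-body : ∀ {n C} → C ∈ P → (σ : ℕ → Term ⊥) → LevelBelow (suc n) (substAtom σ (head C)) →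
                          BoundedGround n (substBody σ (body C))
    bounded-ground-body {n} {C} C∈P σ head< = go [] (substBody σ (body C)) refl []
      where
      H : Base P
      H = base (substAtom σ (head C)) (inj₁ (lose C∈P refl))

      go : ∀ 𝐀 𝐁 → 𝐀 ++ 𝐁 ≡ substBody σ (body C) → ⊨Ground M 𝐀 → BoundedGround n 𝐁
      go 𝐀 []      _  _   = Level.lift tt
      go 𝐀 (L ∷ 𝐁) eq ⊨𝐀 =
        (λ B B≡L → ≤-pred (≤-trans
          (s≤s (acceptable {A = H} {𝐀 = 𝐀} {L} {𝐁} (C , C∈P , σ , cong (_ ←_) eq) B≡L ⊨𝐀))
          (head< H refl))) ,
        λ ⊨L → go (𝐀 ++ [ L ]) 𝐁 (trans (++-assoc 𝐀 [ L ] 𝐁) eq) (All.++⁺ ⊨𝐀 ⊨L)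

    -- A ground instance of `𝐁θ` is the body of a ground instance of the program clause, whose head
    -- is a ground instance of `A`; acceptability then lowers the bound by one.
    bounded-resolvent : ∀ {n A C H 𝐁} {θ : ℕ → Term ℕ} → C ∈ P → Variant (H ← 𝐁) C →
                        substAtom θ A ≡ substAtom θ H → BoundedLiteral (suc n) (pos A) →
                        Bounded n (substBody θ 𝐁)
    bounded-resolvent {n} {A} {C@(H₀ ← 𝐁₀)} {H} {𝐁} {θ} C∈P ((η , refl) , _) Aθ≡Hθ A< σ =
      subst (BoundedGround n) (sym (trans (substBody-⊙ σ θ 𝐁) (substBody-⊙ (σ ⊙ θ) (fun η) 𝐁₀)))
        (bounded-ground-body C∈P ((σ ⊙ θ) ⊙ fun η)
          (subst (LevelBelow (suc n)) Aσθ≡ (A< (σ ⊙ θ))))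
      where
      Aσθ≡ : substAtom (σ ⊙ θ) A ≡ substAtom ((σ ⊙ θ) ⊙ fun η) H₀
      Aσθ≡ = trans (sym (substAtom-⊙ σ θ A)) (trans (cong (substAtom σ) Aθ≡Hθ)
               (trans (substAtom-⊙ σ θ H) (substAtom-⊙ (σ ⊙ θ) (fun η) H₀)))

    -- The truth of `Lθ` discharges the condition under which the tail is bounded.
    bounded-tail : ∀ {n L 𝐁} (θ : ℕ → Term ℕ) → (∀ ρ → ⊨Literal ρ (substLiteral θ L)) →
                   Bounded n (L ∷ 𝐁) → Bounded n (substBody θ 𝐁)
    bounded-tail {n} {L} {𝐁} θ ⊨Lθ bounded σ =
      subst (BoundedGround n) (sym (substBody-⊙ σ θ 𝐁))
        (proj₂ (bounded (σ ⊙ θ))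
          (subst (⊨Literal _) (substLiteral-⊙ σ θ L) (⊨Literal-subst⁺ (substLiteral θ L) (⊨Lθ _)) ∷ []))

    FiniteAfterBody : Query → Query → Set _
    FiniteAfterBody 𝐁 𝐋 = ∀ (θ : ℕ → Term ℕ) → WellModed (substBody θ 𝐋) →
      (∀ ρ → ⊨Body ρ (substBody θ 𝐁)) → AllDerivationsFinite G (substBody θ 𝐋)

    mutual
      -- The recursion is lexicographic in `n` and `k`. The tail of the body gets instantiated, so
      -- it is not a structural part, but its length is kept; calls of atoms defined in `P` lower
      -- `n`.
      finite-body : ∀ n k 𝐁 {𝐋} → length 𝐁 ≤ k → Bounded n 𝐁 → All NegCompleted 𝐁 →
                    WellModed (𝐁 ++ 𝐋) → FiniteAfterBody 𝐁 𝐋 → AllDerivationsFinite G (𝐁 ++ 𝐋)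
      finite-body n k [] {𝐋} _ _ _ w after =
        subst (AllDerivationsFinite G) (substBody-var 𝐋)
          (after var (subst WellModed (sym (substBody-var 𝐋)) w) λ _ → [])
      finite-body n (suc k) (L ∷ 𝐁) {𝐋} (s≤s 𝐁≤k) bounded (c ∷ cs) w after =
        finite-literal n {L} (λ _ σ → proj₁ (bounded σ)) w λ θ w′ ⊨Lθ →
          subst (AllDerivationsFinite G) (sym (map-++ _ 𝐁 𝐋))
            (finite-body n k (substBody θ 𝐁) (subst (_≤ k) (sym (length-map _ 𝐁)) 𝐁≤k)
              (bounded-tail {L = L} {𝐁} θ (⊨Lθ c) bounded) (NegCompleted-subst cs)
              (subst WellModed (map-++ _ 𝐁 𝐋) w′)
              -- Finishing the tail with `θ′` finishes the whole body with `θ′ ⊙ θ`; the first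
              -- literal remains true because `Lθ` is true under every assignment.
              λ θ′ w″ ⊨𝐁 → subst (AllDerivationsFinite G) (sym (substBody-⊙ θ′ θ 𝐋))
                (after (θ′ ⊙ θ) (subst WellModed (substBody-⊙ θ′ θ 𝐋) w″) λ ρ →
                  subst (⊨Literal ρ) (substLiteral-⊙ θ′ θ L) (⊨Literal-subst⁺ (substLiteral θ L) (⊨Lθ c _)) ∷
                  subst (⊨Body ρ) (substBody-⊙ θ′ θ 𝐁) (⊨𝐁 ρ)))

      finite-literal : ∀ n {L 𝐋} → (Defined P (rel (atomOf L)) → BoundedLiteral n L) →
                       WellModed (L ∷ 𝐋) → FiniteAfter L 𝐋 → AllDerivationsFinite G (L ∷ 𝐋)
      finite-literal n {pos A} bounded w after = finite-atom n {A} bounded w after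
      finite-literal n {neg A} {𝐋} bounded w after = finite-by-step λ
        { (resolvent (positive ()))
        ; s@(resolvent (negative g T ff)) →
            subst (AllDerivationsFinite G) (substBody-var 𝐋)
              -- A negative literal computes no bindings, so its answer is the identity.
              (after var (subst WellModed (sym (substBody-var 𝐋)) (wellModed-step s w)) λ c ρ →
                subst (⊨Literal ρ) (sym (substLiteral-var (neg A)))
                  λ ⊨A → finitelyFailed-sound T (c ∷ []) ff ρ (⊨A ∷ []))
        -- In its subsidiary tree `A` is followed by the empty query.
        ; s@(subsidiary g) → finite-atom n {A} bounded (wellModed-step s w) λ _ _ _ → finite-[]
        }

      finite-atom : ∀ n {A 𝐋} → (Defined P (rel A) → BoundedLiteral n (pos A)) →
                    WellModed (pos A ∷ 𝐋) → FiniteAfter (pos A) 𝐋 → AllDerivationsFinite G (pos A ∷ 𝐋)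
      finite-atom n {A} {𝐋} bounded w after derivation = ¬¬-excluded-middle λ
        { (yes d) → finite-defined n d (bounded d) w after derivation
        ; (no ¬d) → finite-notInP ¬d (finite-R [ pos A ] (wellModedQuery-literal (wellModed-literal {pos A} {𝐋} w)))
                      w after derivation
        }

      finite-defined : ∀ n {A 𝐋} → Defined P (rel A) → BoundedLiteral n (pos A) →
                       WellModed (pos A ∷ 𝐋) → FiniteAfter (pos A) 𝐋 → AllDerivationsFinite G (pos A ∷ 𝐋)
      -- Some ground instance exists, and its level cannot be below zero.
      finite-defined zero {A} d bounded _ _ with bounded constant (base (substAtom constant A) (inj₁ d)) refl
      ... | ()
      finite-defined (suc n) {A} {𝐋} d bounded w after = finite-by-step λ
        { s@(resolvent (positive (resolve {H = H} {𝐁 = 𝐁} {θ = θ′} C∈G v apart mgu))) →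
            let θ    = fun θ′
                Aθ≡Hθ = proj₁ mgu
                𝐁𝐋≡  = map-++ (substLiteral θ) 𝐁 𝐋
            in
            subst (AllDerivationsFinite G) (sym 𝐁𝐋≡)
              (finite-body n _ (substBody θ 𝐁) ≤-refl
                (bounded-resolvent {A = A} {θ = θ} (clause-of-P {A} {θ = θ} d C∈G v Aθ≡Hθ) v Aθ≡Hθ bounded)
                (NegCompleted-subst (NegCompleted-variant C∈G v))
                (subst WellModed 𝐁𝐋≡ (wellModed-step s w))
                -- When the body is true under its answer `η`, so is the head, which is `A`
                -- instantiated by `η ⊙ θ`.
                λ η w′ ⊨𝐁 → subst (AllDerivationsFinite G) (sym (substBody-⊙ η θ 𝐋))
                  (after (η ⊙ θ) (subst WellModed (substBody-⊙ η θ 𝐋) w′) λ _ ρ →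
                    subst (⊨Atom ρ) (substAtom-⊙ η θ A)
                      (⊨Literal-subst⁺ (pos (substAtom θ A))
                        (clause-sound {A} C∈G v Aθ≡Hθ (⊨Body-subst⁻ (substBody θ 𝐁) (⊨𝐁 ρ))))))
        }

    -- The input terms are ground, so both instances agree at all input positions.
    level-moded : ∀ {A} (σ τ : ℕ → Term ⊥) → (∀ {x} → ¬ In m A x) → .(d : Defined P (rel A)) →
                  ∣ base (substAtom σ A) (inj₁ d) ∣ ≡ ∣ base (substAtom τ A) (inj₁ d) ∣
    level-moded {p $ ts} σ τ ground d = moded (inj₁ d) λ i i-input →
      trans (lookup-substTerms ts i)
        (trans (substTerm-local (lookup ts i) λ x∈ → contradiction (i , i-input , x∈) ground)
          (sym (lookup-substTerms ts i)))

    bounded-wellModed : ∀ {L 𝐋} → WellModed (L ∷ 𝐋) → Defined P (rel (atomOf L)) → ∃[ n ] BoundedLiteral n L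
    bounded-wellModed {L} (ground , _) d =
      -- One ground instance fixes the level of all of them; the successor makes the bound strict.
      suc (∣ base (substAtom constant (atomOf L)) (inj₁ d) ∣) , λ σ B B≡ →
        s≤s (≤-reflexive (at-instance σ B (trans B≡ (atomOf-subst σ L))))
      where
      at-instance : ∀ σ (B : Base P) → atom B ≡ substAtom σ (atomOf L) →
                    ∣ B ∣ ≡ ∣ base (substAtom constant (atomOf L)) (inj₁ d) ∣
      at-instance σ (base _ _) refl = level-moded {atomOf L} σ constant ground d

    -- Every literal receives a level bound of its own when it is called, because the query remains
    -- well-moded after each answer.
    finite-query : ∀ k Q → length Q ≤ k → WellModed Q → AllDerivationsFinite G Q
    finite-query _ [] _ _ = finite-[]
    finite-query (suc k) (L ∷ Q) (s≤s Q≤k) w derivation = ¬¬-excluded-middle λ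
      { (yes d) → let n , bounded = bounded-wellModed {L} {Q} w d in
                  finite-literal n {L} (λ _ → bounded) w after derivation
      -- The bound is vacuous for a literal not defined in `P`, so `0` is an arbitrary default.
      ; (no ¬d) → finite-literal 0 {L} (⊥-elim ∘ ¬d) w after derivation
      }
      where
      after : FiniteAfter L Q
      after θ w′ _ = finite-query k (substBody θ Q) (subst (_≤ k) (sym (length-map _ Q)) Q≤k) w′

corollary34 : ∀ {c ℓ r} (S : Signature) → let open LogicPrograms S in
    (m : Moding) (P R : Program) →
    WellModedProgram m (P ++ R) →
    P Extends R →
    (M : Interpretation c ℓ r) → CompleteModel M (P ++ R) →
    (∣_∣ : LevelMapping P) → Moded m ∣_∣ → Acceptable P ∣_∣ M →
    (∀ Q → WellModedQuery m Q → AllDerivationsFinite R Q) →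
    ∀ Q → WellModedQuery m Q → AllDerivationsFinite (P ++ R) Q
corollary34 S m P R wellModed extends M complete ∣_∣ moded acceptable finite-R Q w =
  finite-query ∣_∣ moded acceptable finite-R (length Q) Q ≤-refl
    (WellModedFrom⁺ Q λ eq x∈ → inj₂ (w eq x∈))
  where
  open Modes S m
  open Termination S m P R wellModed extends M complete
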